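{- Let $m\ge 1$ be an integer. Then each of the seven quadratic sums $$\sum_{n=1}^\infty \frac{L_n^2(1)}{n^{2m}}(-1)^{n-1},\quad \sum_{n=1}^\infty \frac{H_nL_n(1)}{n^{2m}},\quad \sum_{n=1}^\infty \frac{H_nL_n(1)}{n^{2m}}(-1)^{n-1},\quad \sum_{n=1}^\infty \frac{H_n^2}{n^{2m}},$$ $$\sum_{n=1}^\infty \frac{H_n^2}{n^{2m}}(-1)^{n-1},\quad \sum_{n=1}^\infty \frac{L_n^2(1)}{n^{2m}},\quad \sum_{n=1}^\infty \frac{H_n^2}{(2n+1)^{2m}}$$ is reducible to linear sums (and zeta values), i.e. it can be written as a polynomial with rational coefficients in $\ln 2$, the zeta values $\zeta(k)$ ($k\ge 2$ an integer), and the linear Euler sums $$\sum_{n=1}^\infty \frac{\zeta_n(p)}{n^q},\quad \sum_{n=1}^\infty \frac{L_n(p)}{n^q},\quad \sum_{n=1}^\infty \frac{\zeta_n(p)}{n^q}(-1)^{n-1},\quad \sum_{n=1}^\infty \frac{L_n(p)}{n^q}(-1)^{n-1}\qquad (p\ge 1,\ q\ge 2 \text{ integers}).$$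
   Context: For integers $n,k\ge1$: $H_n=\sum_{j=1}^n \frac1j$, $\zeta_n(k)=\sum_{j=1}^n \frac1{j^k}$, $L_n(k)=\sum_{j=1}^n \frac{(-1)^{j-1}}{j^k}$. Here $\zeta$ is the Riemann zeta function. -}

module Defs where

open import Data.Nat.Base as ℕ using (ℕ; zero; suc; NonZero; z≤n; s≤s)
import Data.Nat.Properties as ℕ
import Data.Integer.Base as ℤ
import Data.Integer.Properties as ℤ
open import Data.Integer.Base using (+_; +[1+_])
open import Data.List.Base using (List; []; _∷_; foldr)
open import Data.Product.Base using (Σ-syntax; ∃-syntax; _×_; _,_)
open import Data.Rational.Base
  using (ℚ; mkℚ; 0ℚ; 1ℚ; _+_; _*_; _-_; -_; _/_; 1/_; ∣_∣; _≤_; _<_; *≤*; *<*; toℚᵘ; fromℚᵘ;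
         nonNegative; positive; Positive; NonNegative)
open import Data.Rational.Properties
import Data.Rational.Unnormalised.Base as ℚᵘ
import Data.Rational.Unnormalised.Properties as ℚᵘ
open import Data.Rational.Solver using (module +-*-Solver)
open import Data.Sum.Base using (_⊎_; inj₁; inj₂)
open import Relation.Binary.PropositionalEquality
  using (_≡_; refl; sym; trans; cong; cong₂; subst; subst₂)

∑ : ℕ → ((j : ℕ) .{{_ : NonZero j}} → ℚ) → ℚ
∑ zero    f = 0ℚ
∑ (suc n) f = ∑ n f + f (suc n)

infix 8 1/_^_

1/_^_ : (j k : ℕ) .{{_ : NonZero j}} → ℚ
1/ j ^ k = _/_ (+ 1) (j ℕ.^ k) {{ℕ.m^n≢0 j k}}

-- sgn j = (-1)^(j-1) for j ≥ 1
sgn : (j : ℕ) .{{_ : NonZero j}} → ℚ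
sgn (suc zero)      = 1ℚ
sgn (suc j@(suc _)) = - sgn j

H : ℕ → ℚ
H n = ∑ n λ j → + 1 / j

ζₙ : ℕ → ℕ → ℚ
ζₙ n k = ∑ n λ j → 1/ j ^ k

L : ℕ → ℕ → ℚ
L n k = ∑ n λ j → sgn j * 1/ j ^ k

Cauchy : (ℕ → ℚ) → Set
Cauchy s = ∀ ε → 0ℚ < ε → ∃[ N ] (∀ m n → N ℕ.≤ m → N ℕ.≤ n → ∣ s m - s n ∣ < ε)

record ℝ : Set where
  constructor real
  field
    seq    : ℕ → ℚ
    cauchy : Cauchy seq

open ℝ

-- ℝ is used as a setoid: equal reals are those whose sequences differ by a null sequence.
infix 4 _≃_

_≃_ : ℝ → ℝ → Set
x ≃ y = ∀ ε → 0ℚ < ε → ∃[ N ] (∀ n → N ℕ.≤ n → ∣ seq x n - seq y n ∣ < ε)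

module CauchyLemmas where
  open +-*-Solver

  sub : ∀ {p q} → 0ℚ ≤ q - p → p ≤ q
  sub {p} {q} h = subst₂ _≤_ (+-identityˡ p)
    (solve 2 (λ p q → (q :- p) :+ p := q) refl p q) (+-monoˡ-≤ p h)

  sub⁻ : ∀ {p q} → p ≤ q → 0ℚ ≤ q - p
  sub⁻ {p} {q} h = subst (_≤ q - p) (+-inverseʳ p) (+-monoˡ-≤ (- p) h)

  *-nonneg : ∀ {p q} → 0ℚ ≤ p → 0ℚ ≤ q → 0ℚ ≤ p * q
  *-nonneg {p} {q} a b = nonNegative⁻¹ (p * q)
    {{nonNeg*nonNeg⇒nonNeg p {{nonNegative a}} q {{nonNegative b}}}}

  +-nonneg : ∀ {p q} → 0ℚ ≤ p → 0ℚ ≤ q → 0ℚ ≤ p + q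
  +-nonneg = +-mono-≤

  *-pos : ∀ {p q} → 0ℚ < p → 0ℚ < q → 0ℚ < p * q
  *-pos {p} {q} a b = positive⁻¹ (p * q)
    {{pos*pos⇒pos p {{positive a}} q {{positive b}}}}

  *-mono : ∀ {p q r s} → 0ℚ ≤ p → 0ℚ ≤ s → p ≤ q → r ≤ s → p * r ≤ q * s
  *-mono {p} {q} {r} {s} a b c d = ≤-trans
    (*-monoˡ-≤-nonNeg p {{nonNegative a}} d) (*-monoʳ-≤-nonNeg s {{nonNegative b}} c)

  half : ℚ → ℚ
  half ε = ε * (+ 1 / 2)

  half-pos : ∀ {ε} → 0ℚ < ε → 0ℚ < half ε
  half-pos {ε} h = *-pos h (positive⁻¹ (+ 1 / 2))

  half+half : ∀ ε → half ε + half ε ≡ ε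
  half+half ε = trans (sym (*-distribˡ-+ ε (+ 1 / 2) (+ 1 / 2))) (*-identityʳ ε)

  ∣-∣-comm : ∀ p q → ∣ p - q ∣ ≡ ∣ q - p ∣
  ∣-∣-comm p q = trans (sym (∣-p∣≡∣p∣ (p - q)))
    (cong ∣_∣ (solve 2 (λ p q → :- (p :- q) := q :- p) refl p q))

  const-cauchy : ∀ c → Cauchy (λ _ → c)
  const-cauchy c ε 0<ε = 0 , λ _ _ _ _ → subst (λ z → ∣ z ∣ < ε) (sym (+-inverseʳ c)) 0<ε

  +-cauchy : ∀ s t → Cauchy s → Cauchy t → Cauchy (λ n → s n + t n)
  +-cauchy s t cs ct ε 0<ε with cs (half ε) (half-pos 0<ε) | ct (half ε) (half-pos 0<ε)
  ... | M , hM | N , hN = M ℕ.⊔ N , λ m n m≥ n≥ → ≤-<-trans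
    (subst (λ z → ∣ z ∣ ≤ ∣ s m - s n ∣ + ∣ t m - t n ∣)
      (solve 4 (λ a b c d → (a :- b) :+ (c :- d) := (a :+ c) :- (b :+ d)) refl
        (s m) (s n) (t m) (t n))
      (∣p+q∣≤∣p∣+∣q∣ (s m - s n) (t m - t n)))
    (subst (∣ s m - s n ∣ + ∣ t m - t n ∣ <_) (half+half ε)
      (+-mono-<
        (hM m n (ℕ.≤-trans (ℕ.m≤m⊔n M N) m≥) (ℕ.≤-trans (ℕ.m≤m⊔n M N) n≥))
        (hN m n (ℕ.≤-trans (ℕ.m≤n⊔m M N) m≥) (ℕ.≤-trans (ℕ.m≤n⊔m M N) n≥))))

  bound : ∀ s → Cauchy s → ∃[ B ] ∃[ N ] (0ℚ < B × (∀ n → N ℕ.≤ n → ∣ s n ∣ ≤ B))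
  bound s cs with cs 1ℚ (positive⁻¹ 1ℚ)
  ... | N , h = 1ℚ + ∣ s N ∣ , N , +-mono-<-≤ (positive⁻¹ 1ℚ) (0≤∣p∣ (s N)) , λ n n≥ →
    subst (λ z → ∣ z ∣ ≤ 1ℚ + ∣ s N ∣)
      (solve 2 (λ a b → (a :- b) :+ b := a) refl (s n) (s N))
      (≤-trans (∣p+q∣≤∣p∣+∣q∣ (s n - s N) (s N))
        (+-monoˡ-≤ ∣ s N ∣ (<⇒≤ (h n N n≥ ℕ.≤-refl))))

  shrink : ∀ ε B → 0ℚ < ε → 0ℚ < B → ∃[ δ ] (0ℚ < δ × B * δ ≡ ε)
  shrink ε B 0<ε 0<B = 1/B * ε
    , *-pos (positive⁻¹ 1/B {{1/pos⇒pos B {{positive 0<B}}}}) 0<ε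
    , trans (sym (*-assoc B 1/B ε))
        (trans (cong (_* ε) (*-inverseʳ B {{B≢0}})) (*-identityˡ ε))
    where
    B≢0 = pos⇒nonZero B {{positive 0<B}}
    1/B = (1/ B) {{B≢0}}

  ∣*∣-bound : ∀ a b {B δ} → 0ℚ < B → ∣ a ∣ ≤ B → ∣ b ∣ < δ → ∣ a * b ∣ < B * δ
  ∣*∣-bound a b {B} {δ} 0<B a≤ b< = subst (_< B * δ) (sym (∣p*q∣≡∣p∣*∣q∣ a b))
    (≤-<-trans (*-monoʳ-≤-nonNeg ∣ b ∣ {{∣-∣-nonNeg b}} a≤)
               (*-monoʳ-<-pos B {{positive 0<B}} b<))

  *-close : ∀ a b c d → ∣ a * c - b * d ∣ ≤ ∣ a * (c - d) ∣ + ∣ d * (a - b) ∣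
  *-close a b c d = subst (λ z → ∣ z ∣ ≤ ∣ a * (c - d) ∣ + ∣ d * (a - b) ∣)
    (solve 4 (λ a b c d → a :* (c :- d) :+ d :* (a :- b) := a :* c :- b :* d) refl a b c d)
    (∣p+q∣≤∣p∣+∣q∣ (a * (c - d)) (d * (a - b)))

  ⊔-split : ∀ i j {k} → i ℕ.⊔ j ℕ.≤ k → i ℕ.≤ k × j ℕ.≤ k
  ⊔-split i j p = ℕ.m⊔n≤o⇒m≤o i j p , ℕ.m⊔n≤o⇒n≤o i j p

  *-cauchy′ : ∀ (s t : ℕ → ℚ) ε {B C β γ K J M N} → 0ℚ < B → 0ℚ < C →
    B * β ≡ half ε → C * γ ≡ half ε →
    (∀ n → K ℕ.≤ n → ∣ s n ∣ ≤ B) → (∀ n → J ℕ.≤ n → ∣ t n ∣ ≤ C) →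
    (∀ m n → M ℕ.≤ m → M ℕ.≤ n → ∣ s m - s n ∣ < γ) →
    (∀ m n → N ℕ.≤ m → N ℕ.≤ n → ∣ t m - t n ∣ < β) →
    ∀ m n → (K ℕ.⊔ J) ℕ.⊔ (M ℕ.⊔ N) ℕ.≤ m → (K ℕ.⊔ J) ℕ.⊔ (M ℕ.⊔ N) ℕ.≤ n →
    ∣ s m * t m - s n * t n ∣ < ε
  *-cauchy′ s t ε {B} {C} {β} {γ} {K} {J} {M} {N} 0<B 0<C Bβ Cγ hB hC hM hN m n m≥ n≥
    with ⊔-split (K ℕ.⊔ J) (M ℕ.⊔ N) m≥ | ⊔-split (K ℕ.⊔ J) (M ℕ.⊔ N) n≥
  ... | KJ≤m , MN≤m | KJ≤n , MN≤n
    with ⊔-split K J KJ≤m | ⊔-split M N MN≤m | ⊔-split K J KJ≤n | ⊔-split M N MN≤n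
  ... | K≤m , _ | M≤m , N≤m | _ , J≤n | M≤n , N≤n = ≤-<-trans
    (*-close (s m) (s n) (t m) (t n))
    (subst (∣ s m * (t m - t n) ∣ + ∣ t n * (s m - s n) ∣ <_) (half+half ε)
      (+-mono-<
        (subst (∣ s m * (t m - t n) ∣ <_) Bβ
          (∣*∣-bound (s m) (t m - t n) 0<B (hB m K≤m) (hN m n N≤m N≤n)))
        (subst (∣ t n * (s m - s n) ∣ <_) Cγ
          (∣*∣-bound (t n) (s m - s n) 0<C (hC n J≤n) (hM m n M≤m M≤n)))))

  *-cauchy : ∀ s t → Cauchy s → Cauchy t → Cauchy (λ n → s n * t n)
  *-cauchy s t cs ct ε 0<ε =
    let (B , K , 0<B , hB) = bound s cs
        (C , J , 0<C , hC) = bound t ct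
        (β , 0<β , Bβ) = shrink (half ε) B (half-pos 0<ε) 0<B
        (γ , 0<γ , Cγ) = shrink (half ε) C (half-pos 0<ε) 0<C
        (M , hM) = cs γ 0<γ
        (N , hN) = ct β 0<β
    in (K ℕ.⊔ J) ℕ.⊔ (M ℕ.⊔ N) ,
       *-cauchy′ s t ε {B} {C} {β} {γ} {K} {J} {M} {N} 0<B 0<C Bβ Cγ hB hC hM hN

open CauchyLemmas

constᴿ : ℚ → ℝ
constᴿ c = real (λ _ → c) (const-cauchy c)

infixl 6 _+ᴿ_
infixl 7 _*ᴿ_

_+ᴿ_ : ℝ → ℝ → ℝ
x +ᴿ y = real (λ n → seq x n + seq y n) (+-cauchy (seq x) (seq y) (cauchy x) (cauchy y))

_*ᴿ_ : ℝ → ℝ → ℝ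
x *ᴿ y = real (λ n → seq x n * seq y n) (*-cauchy (seq x) (seq y) (cauchy x) (cauchy y))

Summable : ((n : ℕ) .{{_ : NonZero n}} → ℚ) → Set
Summable a = Cauchy (λ N → ∑ N a)

∑∞ : (a : (n : ℕ) .{{_ : NonZero n}} → ℚ) → Summable a → ℝ
∑∞ a s = real (λ N → ∑ N a) s

n+i≢0 : ∀ n i .{{_ : NonZero i}} → NonZero (n ℕ.+ i)
n+i≢0 n i = ℕ.>-nonZero (ℕ.≤-trans (ℕ.>-nonZero⁻¹ i) (ℕ.m≤n+m i n))

-- The right-endpoint Riemann sum of ∫₁² dx/x with N equal parts:
-- (1/N) ∑ᵢ 1/(1 + i/N) = ∑ᵢ 1/(N + i), 1 ≤ i ≤ N.
ln2-approx : ℕ → ℚ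
ln2-approx N = ∑ N λ i → _/_ (+ 1) (N ℕ.+ i) {{n+i≢0 N i}}

module SeriesLemmas where
  open +-*-Solver

  r : ℕ → ℚ
  r n = + 1 / suc n

  ι : ℕ → ℚ
  ι n = + n / 1

  fromℚᵘ-+ : ∀ p q → fromℚᵘ (p ℚᵘ.+ q) ≡ fromℚᵘ p + fromℚᵘ q
  fromℚᵘ-+ p q = toℚᵘ-injective (ℚᵘ.≃-trans (toℚᵘ-fromℚᵘ (p ℚᵘ.+ q))
    (ℚᵘ.≃-sym (ℚᵘ.≃-trans (toℚᵘ-homo-+ (fromℚᵘ p) (fromℚᵘ q))
      (ℚᵘ.+-cong (toℚᵘ-fromℚᵘ p) (toℚᵘ-fromℚᵘ q)))))

  fromℚᵘ-* : ∀ p q → fromℚᵘ (p ℚᵘ.* q) ≡ fromℚᵘ p * fromℚᵘ q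
  fromℚᵘ-* p q = toℚᵘ-injective (ℚᵘ.≃-trans (toℚᵘ-fromℚᵘ (p ℚᵘ.* q))
    (ℚᵘ.≃-sym (ℚᵘ.≃-trans (toℚᵘ-homo-* (fromℚᵘ p) (fromℚᵘ q))
      (ℚᵘ.*-cong (toℚᵘ-fromℚᵘ p) (toℚᵘ-fromℚᵘ q)))))

  fromℚᵘ-≤ : ∀ {p q} → p ℚᵘ.≤ q → fromℚᵘ p ≤ fromℚᵘ q
  fromℚᵘ-≤ {p} {q} h = toℚᵘ-cancel-≤
    (ℚᵘ.≤-respˡ-≃ (ℚᵘ.≃-sym (toℚᵘ-fromℚᵘ p))
      (ℚᵘ.≤-respʳ-≃ (ℚᵘ.≃-sym (toℚᵘ-fromℚᵘ q)) h))

  0≤r : ∀ n → 0ℚ ≤ r n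
  0≤r n = nonNegative⁻¹ (r n) {{normalize-nonNeg 1 (suc n)}}

  0<r : ∀ n → 0ℚ < r n
  0<r n = positive⁻¹ (r n) {{normalize-pos 1 (suc n)}}

  0≤ι : ∀ n → 0ℚ ≤ ι n
  0≤ι n = nonNegative⁻¹ (ι n) {{normalize-nonNeg n 1}}

  r-mono : ∀ {m n} → m ℕ.≤ n → r n ≤ r m
  r-mono {m} {n} m≤n = fromℚᵘ-≤ {ℚᵘ.mkℚᵘ (+ 1) n} {ℚᵘ.mkℚᵘ (+ 1) m}
    (ℚᵘ.*≤* (ℤ.+≤+ (ℕ.+-monoˡ-≤ 0 (s≤s m≤n))))

  r≤1 : ∀ n → r n ≤ 1ℚ
  r≤1 n = r-mono {0} {n} z≤n

  recip-mono : ∀ a b .{{_ : NonZero a}} .{{_ : NonZero b}} → b ℕ.≤ a → + 1 / a ≤ + 1 / b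
  recip-mono (suc a) (suc b) (s≤s h) = r-mono h

  recip-* : ∀ a b → + 1 / (suc a ℕ.* suc b) ≡ r a * r b
  recip-* a b = fromℚᵘ-* (ℚᵘ.mkℚᵘ (+ 1) a) (ℚᵘ.mkℚᵘ (+ 1) b)

  ι-mono : ∀ {m n} → m ℕ.≤ n → ι m ≤ ι n
  ι-mono {m} {n} m≤n = fromℚᵘ-≤ {ℚᵘ.mkℚᵘ (+ m) 0} {ℚᵘ.mkℚᵘ (+ n) 0}
    (ℚᵘ.*≤* (ℤ.*-monoʳ-≤-nonNeg (+ 1) (ℤ.+≤+ m≤n)))

  ι-+ : ∀ m n → ι (m ℕ.+ n) ≡ ι m + ι n
  ι-+ m n = trans (cong (λ z → fromℚᵘ (ℚᵘ.mkℚᵘ z 0)) eq)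
    (fromℚᵘ-+ (ℚᵘ.mkℚᵘ (+ m) 0) (ℚᵘ.mkℚᵘ (+ n) 0))
    where
    eq : + (m ℕ.+ n) ≡ (+ m) ℤ.* (+ 1) ℤ.+ (+ n) ℤ.* (+ 1)
    eq = trans (ℤ.pos-+ m n) (sym (cong₂ ℤ._+_ (ℤ.*-identityʳ (+ m)) (ℤ.*-identityʳ (+ n))))

  ι-suc : ∀ n → ι (suc n) ≡ ι n + 1ℚ
  ι-suc n = trans (ι-+ 1 n) (+-comm 1ℚ (ι n))

  ι*r : ∀ n → ι (suc n) * r n ≡ 1ℚ
  ι*r n = trans (sym (fromℚᵘ-* (ℚᵘ.mkℚᵘ (+ suc n) 0) (ℚᵘ.mkℚᵘ (+ 1) n)))
    (fromℚᵘ-cong {ℚᵘ.mkℚᵘ (+ suc n) 0 ℚᵘ.* ℚᵘ.mkℚᵘ (+ 1) n} {ℚᵘ.mkℚᵘ (+ 1) 0}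
      (ℚᵘ.*≡* (cong +_ eq)))
    where
    eq : suc n ℕ.* 1 ℕ.* 1 ≡ 1 ℕ.* (1 ℕ.* suc n)
    eq = trans (ℕ.*-identityʳ _) (trans (ℕ.*-comm (suc n) 1) (sym (ℕ.*-identityˡ _)))

  -- 1/(n(n+1)) = 1/n − 1/(n+1)
  r-diff : ∀ n → r n - r (suc n) ≡ r n * r (suc n)
  r-diff n = trans (cong₂ _-_ (a (r n) (ι*r (suc n))) (a (r (suc n)) (ι*r n)))
    (trans (cong (λ z → r n * (z * r (suc n)) - r (suc n) * (ι (suc n) * r n)) (ι-suc (suc n)))
      (solve 3 (λ i x y → x :* ((i :+ con 1ℚ) :* y) :- y :* (i :* x) := x :* y) refl
        (ι (suc n)) (r n) (r (suc n))))
    where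
    a : ∀ x {y} → y ≡ 1ℚ → x ≡ x * y
    a x e = sym (trans (cong (x *_) e) (*-identityʳ x))

  sq : ∀ n → 1/ suc n ^ 2 ≡ r n * r n
  sq n = trans (cong (λ z → + 1 / suc z) (cong (λ z → z ℕ.+ n ℕ.* suc z) (ℕ.*-identityʳ n)))
    (recip-* n n)

  H-nonneg : ∀ n → 0ℚ ≤ H n
  H-nonneg zero    = ≤-refl
  H-nonneg (suc n) = +-nonneg (H-nonneg n) (0≤r n)

  H≤ι : ∀ n → H n ≤ ι n
  H≤ι zero    = ≤-refl
  H≤ι (suc n) = subst (H (suc n) ≤_) (sym (ι-suc n)) (+-mono-≤ (H≤ι n) (r≤1 n))

  ≤+ˡ : ∀ {p q} → 0ℚ ≤ q → p ≤ p + q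
  ≤+ˡ {p} {q} h = subst (_≤ p + q) (+-identityʳ p) (+-monoʳ-≤ p h)

  H-bound : ∀ K n → H n ≤ ι (suc K) + ι n * r K
  H-bound K zero    = ≤-trans (H≤ι 0)
    (+-nonneg (0≤ι (suc K)) (*-nonneg (0≤ι 0) (0≤r K)))
  H-bound K (suc n) with ℕ.≤-total n K
  ... | inj₁ n≤K = ≤-trans (H≤ι (suc n)) (≤-trans (ι-mono (s≤s n≤K))
                     (≤+ˡ (*-nonneg (0≤ι (suc n)) (0≤r K))))
  ... | inj₂ K≤n = ≤-trans (+-mono-≤ (H-bound K n) (r-mono K≤n)) (≤-reflexive
    (trans (solve 3 (λ a b c → (a :+ b :* c) :+ c := a :+ (b :+ con 1ℚ) :* c) refl
             (ι (suc K)) (ι n) (r K))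
           (cong (λ z → ι (suc K) + z * r K) (sym (ι-suc n)))))

  -- A majorant whose differences dominate H n / n²; every series and sequence
  -- below is shown to converge by comparison with it.
  β : ℕ → ℚ
  β k = (H (suc k) + ι 2) * r k

  0≤β : ∀ k → 0ℚ ≤ β k
  0≤β k = *-nonneg (+-nonneg (H-nonneg (suc k)) (0≤ι 2)) (0≤r k)

  β-step : ∀ k → H (suc (suc k)) * 1/ suc (suc k) ^ 2 ≤ β k - β (suc k)
  β-step k = subst₂ _≤_ (cong ((h + y) *_) (sym (sq (suc k)))) (sym eq)
    (sub (subst (0ℚ ≤_)
      (solve 3 (λ h x y → (h :+ con (ι 2)) :* (x :- y) :* y :+ (con 1ℚ :- y) :* (y :* y)
                  := ((h :+ con (ι 2)) :* (x :* y) :- y :* y) :- (h :+ y) :* (y :* y)) refl h x y)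
      (+-nonneg
        (*-nonneg (*-nonneg (+-nonneg (H-nonneg (suc k)) (0≤ι 2)) (sub⁻ (r-mono (ℕ.n≤1+n k))))
                  (0≤r (suc k)))
        (*-nonneg (sub⁻ (r≤1 (suc k))) (*-nonneg (0≤r (suc k)) (0≤r (suc k)))))))
    where
    h = H (suc k)
    x = r k
    y = r (suc k)
    eq : β k - β (suc k) ≡ (h + ι 2) * (x * y) - y * y
    eq = trans
      (solve 3 (λ h x y → (h :+ con (ι 2)) :* x :- ((h :+ y) :+ con (ι 2)) :* y
                  := (h :+ con (ι 2)) :* (x :- y) :- y :* y) refl h x y)
      (cong (λ z → (h + ι 2) * z - y * y) (r-diff k))

  β-small : ∀ ε → 0ℚ < ε → ∃[ N ] (∀ k → N ℕ.≤ k → β k < ε)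
  β-small ε@(mkℚ +[1+ p ] q _) _ = N , λ k N≤k → <-≤-trans (≤-<-trans (low k N≤k) mid) rq≤ε
    where
    K = q ℕ.+ (suc q ℕ.+ (suc q ℕ.+ 0))
    N = suc K ℕ.* suc (suc (suc K))
    low : ∀ k → N ℕ.≤ k → β k ≤ r K + r K
    low k N≤k = ≤-trans
      (*-monoʳ-≤-nonNeg (r k) {{nonNegative (0≤r k)}} (+-monoˡ-≤ (ι 2) (H-bound K (suc k))))
      (subst (_≤ r K + r K)
        (solve 4 (λ a i c x → (a :+ con (ι 2)) :* x :+ (i :* x) :* c
                    := ((a :+ i :* c) :+ con (ι 2)) :* x) refl
          (ι (suc K)) (ι (suc k)) (r K) (r k))
        (+-mono-≤ first (≤-reflexive (trans (cong (_* r K) (ι*r k)) (*-identityˡ (r K))))))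
      where
      eqN : (ι (suc K) + ι 2) * (r K * r (suc (suc K))) ≡ r K
      eqN = trans (cong (_* (r K * r (suc (suc K))))
               (trans (sym (ι-+ (suc K) 2)) (cong ι (ℕ.+-comm (suc K) 2))))
             (trans (solve 3 (λ i x y → i :* (x :* y) := x :* (i :* y)) refl
                      (ι (suc (suc (suc K)))) (r K) (r (suc (suc K))))
               (trans (cong (r K *_) (ι*r (suc (suc K)))) (*-identityʳ (r K))))
      rk≤ : r k ≤ r K * r (suc (suc K))
      rk≤ = subst (r k ≤_) (recip-* K (suc (suc K)))
        (recip-mono (suc k) N (ℕ.≤-trans N≤k (ℕ.n≤1+n k)))
      first : (ι (suc K) + ι 2) * r k ≤ r K
      first = subst ((ι (suc K) + ι 2) * r k ≤_) eqN
        (*-monoˡ-≤-nonNeg (ι (suc K) + ι 2)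
          {{nonNegative (+-nonneg (0≤ι (suc K)) (0≤ι 2))}} rk≤)
    mid : r K + r K < r q
    mid = subst₂ _<_
      (trans (*-distribʳ-+ (r q) (r 2) (r 2)) (cong (λ z → z + z) (sym (recip-* 2 q))))
      (*-identityˡ (r q))
      (*-monoˡ-<-pos (r q) {{positive (0<r q)}} {r 2 + r 2} {1ℚ}
        (*<* (ℤ.+<+ (s≤s (s≤s (s≤s z≤n))))))
    rq≤ε : r q ≤ ε
    rq≤ε = subst (r q ≤_) (fromℚᵘ-toℚᵘ ε) (fromℚᵘ-≤ {ℚᵘ.mkℚᵘ (+ 1) q} {toℚᵘ ε}
      (ℚᵘ.*≤* (ℤ.*-monoʳ-≤-nonNeg (+ suc q) {+ 1} {+ suc p} (ℤ.+≤+ (s≤s z≤n)))))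
  β-small (mkℚ (+ 0) q _) (*<* (ℤ.+<+ ()))
  β-small (mkℚ (ℤ.-[1+ p ]) q _) (*<* ())

  module Increments (s : ℕ → ℚ)
    (inc : ∀ n → ∣ s (suc n) - s n ∣ ≤ H (suc n) * 1/ suc n ^ 2) where

    telescope : ∀ k d → ∣ s (suc (d ℕ.+ k)) - s (suc k) ∣ ≤ β k - β (d ℕ.+ k)
    telescope k zero    = ≤-reflexive (trans (cong ∣_∣ (+-inverseʳ (s (suc k)))) (sym (+-inverseʳ (β k))))
    telescope k (suc d) = subst₂ _≤_
      (cong ∣_∣ (solve 3 (λ a b c → (a :- b) :+ (b :- c) := a :- c) refl
        (s (suc (suc (d ℕ.+ k)))) (s (suc (d ℕ.+ k))) (s (suc k))))
      (solve 3 (λ a b c → (b :- c) :+ (a :- b) := a :- c) refl (β k) (β (d ℕ.+ k)) (β (suc (d ℕ.+ k))))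
      (≤-trans
        (∣p+q∣≤∣p∣+∣q∣ (s (suc (suc (d ℕ.+ k))) - s (suc (d ℕ.+ k))) (s (suc (d ℕ.+ k)) - s (suc k)))
        (+-mono-≤ (≤-trans (inc (suc (d ℕ.+ k))) (β-step (d ℕ.+ k))) (telescope k d)))

    tail : ∀ {k n} → k ℕ.≤ n → ∣ s (suc n) - s (suc k) ∣ ≤ β k
    tail {k} {n} k≤n = subst (λ z → ∣ s (suc z) - s (suc k) ∣ ≤ β k) (ℕ.m∸n+n≡m k≤n)
      (≤-trans (telescope k (n ℕ.∸ k)) (sub (subst (0ℚ ≤_)
        (solve 2 (λ a b → b := a :- (a :- b)) refl (β k) (β (n ℕ.∸ k ℕ.+ k)))
        (0≤β (n ℕ.∸ k ℕ.+ k)))))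

    ordered : ∀ {ε N} → (∀ k → N ℕ.≤ k → β k < ε) →
      ∀ m n → N ℕ.≤ m → N ℕ.≤ n → ∣ s (suc m) - s (suc n) ∣ < ε
    ordered {ε} small m n N≤m N≤n with ℕ.≤-total m n
    ... | inj₁ m≤n = subst (_< ε) (∣-∣-comm (s (suc n)) (s (suc m)))
                       (≤-<-trans (tail m≤n) (small m N≤m))
    ... | inj₂ n≤m = ≤-<-trans (tail n≤m) (small n N≤n)

    increments⇒cauchy : Cauchy s
    increments⇒cauchy ε 0<ε with β-small ε 0<ε
    ... | N , small = suc N , λ where
      (suc m) (suc n) (s≤s N≤m) (s≤s N≤n) → ordered small m n N≤m N≤n

  open Increments using (increments⇒cauchy)

  summable : (a : (n : ℕ) .{{_ : NonZero n}} → ℚ) →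
    (∀ n → ∣ a (suc n) ∣ ≤ H (suc n) * 1/ suc n ^ 2) → Summable a
  summable a h = increments⇒cauchy (λ N → ∑ N a) λ n →
    subst (λ z → ∣ z ∣ ≤ H (suc n) * 1/ suc n ^ 2)
      (solve 2 (λ p q → q := (p :+ q) :- p) refl (∑ n a) (a (suc n))) (h n)

  ∑-bound : (f g : (n : ℕ) .{{_ : NonZero n}} → ℚ) →
    (∀ n → ∣ f (suc n) ∣ ≤ g (suc n)) → ∀ n → ∣ ∑ n f ∣ ≤ ∑ n g
  ∑-bound f g h zero    = ≤-refl
  ∑-bound f g h (suc n) = ≤-trans (∣p+q∣≤∣p∣+∣q∣ (∑ n f) (f (suc n)))
    (+-mono-≤ (∑-bound f g h n) (h n))

  ∣sgn∣ : ∀ n → ∣ sgn (suc n) ∣ ≡ 1ℚ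
  ∣sgn∣ zero    = refl
  ∣sgn∣ (suc n) = trans (∣-p∣≡∣p∣ (sgn (suc n))) (∣sgn∣ n)

  pow-mono : ∀ n {i j} → i ℕ.≤ j → 1/ suc n ^ j ≤ 1/ suc n ^ i
  pow-mono n {i} {j} h = recip-mono (suc n ℕ.^ j) (suc n ℕ.^ i)
    {{ℕ.m^n≢0 (suc n) j}} {{ℕ.m^n≢0 (suc n) i}} (ℕ.^-monoʳ-≤ (suc n) h)

  0≤pow : ∀ n i → 0ℚ ≤ 1/ suc n ^ i
  0≤pow n i = nonNegative⁻¹ (1/ suc n ^ i)
    {{normalize-nonNeg 1 (suc n ℕ.^ i) {{ℕ.m^n≢0 (suc n) i}}}}

  pow-1 : ∀ n → 1/ suc n ^ 1 ≡ r n
  pow-1 n = cong (λ z → + 1 / suc z) (ℕ.*-identityʳ n)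

  ∣pow∣≤r : ∀ n {k} → 1 ℕ.≤ k → ∣ 1/ suc n ^ k ∣ ≤ r n
  ∣pow∣≤r n {k} h = subst₂ _≤_ (sym (0≤p⇒∣p∣≡p (0≤pow n k))) (pow-1 n) (pow-mono n h)

  ∣sgn*∣ : ∀ n x → ∣ sgn (suc n) * x ∣ ≡ ∣ x ∣
  ∣sgn*∣ n x = trans (∣p*q∣≡∣p∣*∣q∣ (sgn (suc n)) x)
    (trans (cong (_* ∣ x ∣) (∣sgn∣ n)) (*-identityˡ ∣ x ∣))

  ∣*sgn∣ : ∀ n x → ∣ x * sgn (suc n) ∣ ≡ ∣ x ∣
  ∣*sgn∣ n x = trans (cong ∣_∣ (*-comm x (sgn (suc n)))) (∣sgn*∣ n x)

  ∣ζₙ∣≤H : ∀ n {k} → 1 ℕ.≤ k → ∣ ζₙ n k ∣ ≤ H n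
  ∣ζₙ∣≤H n {k} h = ∑-bound (λ j → 1/ j ^ k) (λ j → + 1 / j) (λ j → ∣pow∣≤r j h) n

  ∣L∣≤H : ∀ n {k} → 1 ℕ.≤ k → ∣ L n k ∣ ≤ H n
  ∣L∣≤H n {k} h = ∑-bound (λ j → sgn j * 1/ j ^ k) (λ j → + 1 / j)
    (λ j → subst (_≤ r j) (sym (∣sgn*∣ j (1/ suc j ^ k))) (∣pow∣≤r j h)) n

  quotient-bound : ∀ n x {q} → ∣ x ∣ ≤ H (suc n) → 2 ℕ.≤ q →
    ∣ x * 1/ suc n ^ q ∣ ≤ H (suc n) * 1/ suc n ^ 2
  quotient-bound n x {q} h 2≤q = subst (_≤ H (suc n) * 1/ suc n ^ 2)
    (sym (∣p*q∣≡∣p∣*∣q∣ x (1/ suc n ^ q)))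
    (*-mono (0≤∣p∣ x) (0≤pow n 2) h
      (subst (_≤ 1/ suc n ^ 2) (sym (0≤p⇒∣p∣≡p (0≤pow n q))) (pow-mono n 2≤q)))

  1≤H : ∀ n → 1ℚ ≤ H (suc n)
  1≤H zero    = ≤-refl
  1≤H (suc n) = ≤-trans (1≤H n) (≤+ˡ (0≤r (suc n)))

  ζ-summable : ∀ {k} → 2 ℕ.≤ k → Summable (λ n → 1/ n ^ k)
  ζ-summable {k} 2≤k = summable (λ n → 1/ n ^ k) λ n →
    subst (λ z → ∣ z ∣ ≤ H (suc n) * 1/ suc n ^ 2) (*-identityˡ (1/ suc n ^ k))
      (quotient-bound n 1ℚ (1≤H n) 2≤k)

  linear-summable : (A : ℕ → ℚ) → (∀ n → ∣ A n ∣ ≤ H n) → ∀ {q} → 2 ℕ.≤ q →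
    Summable (λ n → A n * 1/ n ^ q)
  linear-summable A h {q} 2≤q = summable (λ n → A n * 1/ n ^ q) λ n →
    quotient-bound n (A (suc n)) (h (suc n)) 2≤q

  alternating-summable : (A : ℕ → ℚ) → (∀ n → ∣ A n ∣ ≤ H n) → ∀ {q} → 2 ℕ.≤ q →
    Summable (λ n → A n * 1/ n ^ q * sgn n)
  alternating-summable A h {q} 2≤q = summable (λ n → A n * 1/ n ^ q * sgn n) λ n →
    subst (_≤ H (suc n) * 1/ suc n ^ 2) (sym (∣*sgn∣ n (A (suc n) * 1/ suc n ^ q)))
      (quotient-bound n (A (suc n)) (h (suc n)) 2≤q)

  private
    -- 1/(M+1) + … + 1/(M+N)
    A : ℕ → ℕ → ℚ
    A M N = ∑ N λ i → _/_ (+ 1) (M ℕ.+ i) {{n+i≢0 M i}}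

    A-shift : ∀ M N → A (suc M) N + r M ≡ A M (suc N)
    A-shift M zero    = cong (λ z → 0ℚ + z) (/-cong {+ 1} {suc M} {+ 1} {M ℕ.+ 1}
                          {{_}} {{n+i≢0 M 1}} refl (ℕ.+-comm 1 M))
    A-shift M (suc N) = trans
      (solve 3 (λ a b c → (a :+ b) :+ c := (a :+ c) :+ b) refl
        (A (suc M) N) (r (M ℕ.+ suc N)) (r M))
      (cong₂ _+_ (A-shift M N)
        (/-cong {+ 1} {suc M ℕ.+ suc N} {+ 1} {M ℕ.+ suc (suc N)}
          {{_}} {{n+i≢0 M (suc (suc N))}} refl (sym (ℕ.+-suc M (suc N)))))

    halves : ∀ N → r (N ℕ.+ suc N) + r (N ℕ.+ suc N) ≡ r N
    halves N = trans (cong (λ z → z + z) (trans (cong (λ z → r (N ℕ.+ z)) (sym (ℕ.+-identityʳ (suc N))))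
                                                (recip-* 1 N)))
      (trans (sym (*-distribʳ-+ (r N) (r 1) (r 1))) (*-identityˡ (r N)))

    A-step : ∀ N → A (suc N) (suc N) - A N N ≡ r (N ℕ.+ N) * r (suc (N ℕ.+ N))
    A-step N = trans
      (solve 4 (λ a b c d → (a :+ b) :- c := ((a :+ d) :- c) :- d :+ b) refl
        (A (suc N) N) (r (N ℕ.+ suc N)) (A N N) (r N))
      (trans (cong₂ (λ u v → (u - A N N) - v + r (N ℕ.+ suc N)) (A-shift N N) (sym (halves N)))
        (trans
          (solve 3 (λ a x y → ((a :+ x) :- a) :- (y :+ y) :+ y := x :- y) refl
            (A N N) (_/_ (+ 1) (N ℕ.+ suc N) {{n+i≢0 N (suc N)}}) (r (N ℕ.+ suc N)))
          (trans (cong₂ _-_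
                   (/-cong {+ 1} {N ℕ.+ suc N} {+ 1} {suc (N ℕ.+ N)} {{n+i≢0 N (suc N)}} refl (ℕ.+-suc N N))
                   (cong r (ℕ.+-suc N N)))
            (r-diff (N ℕ.+ N)))))

  ln2-cauchy : Cauchy ln2-approx
  ln2-cauchy = Increments.increments⇒cauchy ln2-approx λ N →
    subst₂ _≤_
      (sym (trans (cong ∣_∣ (A-step N))
        (0≤p⇒∣p∣≡p (*-nonneg (0≤r (N ℕ.+ N)) (0≤r (suc (N ℕ.+ N)))))))
      (cong (H (suc N) *_) (sym (sq N)))
      (≤-trans
        (*-mono (0≤r (N ℕ.+ N)) (0≤r N) (r-mono (ℕ.m≤m+n N N)) (r-mono (ℕ.m≤n⇒m≤1+n (ℕ.m≤m+n N N))))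
        (subst (_≤ H (suc N) * (r N * r N)) (*-identityˡ (r N * r N))
          (*-monoʳ-≤-nonNeg (r N * r N) {{nonNegative (*-nonneg (0≤r N) (0≤r N))}} (1≤H N))))

open SeriesLemmas

data Generator : Set where
  ln2 : Generator
  ζ   : (k : ℕ) → 2 ℕ.≤ k → Generator
  Sζ  : (p q : ℕ) → 1 ℕ.≤ p → 2 ℕ.≤ q → Generator
  SL  : (p q : ℕ) → 1 ℕ.≤ p → 2 ℕ.≤ q → Generator
  Sζ± : (p q : ℕ) → 1 ℕ.≤ p → 2 ℕ.≤ q → Generator
  SL± : (p q : ℕ) → 1 ℕ.≤ p → 2 ℕ.≤ q → Generator

value : Generator → ℝ
value ln2               = real ln2-approx ln2-cauchy
value (ζ k 2≤k)         = ∑∞ (λ n → 1/ n ^ k) (ζ-summable 2≤k)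
value (Sζ  p q 1≤p 2≤q) = ∑∞ (λ n → ζₙ n p * 1/ n ^ q)
  (linear-summable (λ n → ζₙ n p) (λ n → ∣ζₙ∣≤H n 1≤p) 2≤q)
value (SL  p q 1≤p 2≤q) = ∑∞ (λ n → L n p * 1/ n ^ q)
  (linear-summable (λ n → L n p) (λ n → ∣L∣≤H n 1≤p) 2≤q)
value (Sζ± p q 1≤p 2≤q) = ∑∞ (λ n → ζₙ n p * 1/ n ^ q * sgn n)
  (alternating-summable (λ n → ζₙ n p) (λ n → ∣ζₙ∣≤H n 1≤p) 2≤q)
value (SL± p q 1≤p 2≤q) = ∑∞ (λ n → L n p * 1/ n ^ q * sgn n)
  (alternating-summable (λ n → L n p) (λ n → ∣L∣≤H n 1≤p) 2≤q)

-- A polynomial is a list of terms, each a rational coefficient together with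
-- a monomial, the latter being the list of its factors with multiplicity.
Monomial : Set
Monomial = List Generator

Polynomial : Set
Polynomial = List (ℚ × Monomial)

evalMonomial : Monomial → ℝ
evalMonomial = foldr (λ g x → value g *ᴿ x) (constᴿ 1ℚ)

⟦_⟧ : Polynomial → ℝ
⟦_⟧ = foldr (λ (c , u) x → constᴿ c *ᴿ evalMonomial u +ᴿ x) (constᴿ 0ℚ)

Reducible : ((n : ℕ) .{{_ : NonZero n}} → ℚ) → Set
Reducible a = Σ[ s ∈ Summable a ] ∃[ P ] ∑∞ a s ≃ ⟦ P ⟧

{-# OPTIONS --safe #-}
-- For q even, Σ γⁿ A(n) B(n) / n^q with A(n) = Σ_{j≤n} αʲ/j and B(n) = Σ_{j≤n} βʲ/j is expressed
-- by linear sums through a parity argument that needs partial fractions only.  Consider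
--   T = Σ_n γⁿ n^{2-q} Σ_{k,l} (αᵏ/k) (βˡ/l) (1/((n−k)(n−l)) + 1/((n+k)(n+l))),
-- all indices running up to N and vanishing denominators being skipped.  Summed over k and l
-- first, each of the two parts is Σ γⁿ n^{-q} (αβ)ⁿ A(n) B(n) plus linear sums.  On the other hand
-- the bracket equals (g(n,k) − g(n,l))/(k−l), where g(n,k) = 1/(n−k) − 1/(n+k), plus terms
-- supported on n = k, n = l or k = l; as q is even, the sum of γⁿ n^{2-q} g(n,k) over n is
-- elementary up to terms that vanish as N → ∞, so that T itself reduces to linear sums.
-- The last of the seven sums reduces to the others since H(n) = Σ_{j≤2n+1} (1 + (−1)ʲ)/j.
module Submission where

open import Defs
open import Data.Bool.Base using (Bool; true; false; _xor_)
open import Data.Nat.Base using (ℕ; NonZero; suc) renaming (_*_ to _*ℕ_)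
open import Data.Nat.Base as ℕ using (zero; z≤n; s≤s; _∸_)
import Data.Nat.Properties as ℕ
open import Data.Integer.Base using (+_)
open import Data.List.Base using ([]; _∷_; _++_; map)
open import Data.Product.Base using (_×_; _,_; proj₁; proj₂; ∃-syntax)
open import Data.Rational.Base
  using (ℚ; 0ℚ; 1ℚ; ½; _+_; _*_; _-_; -_; _/_; ∣_∣; _≤_; _<_; nonNegative)
open import Data.Rational.Properties
open import Data.Rational.Solver using (module +-*-Solver)
open import Relation.Binary.PropositionalEquality
  using (_≡_; refl; sym; trans; cong; cong₂; subst; subst₂; module ≡-Reasoning)

open CauchyLemmas
open SeriesLemmas using
  (r; ι; ι*r; ι-suc; ι-+; ι-mono; 0≤r; 0≤ι; r-mono; r≤1; recip-*; H-nonneg; H≤ι; 1≤H; ≤+ˡ; β; β-small)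
open +-*-Solver using (solve; _:=_; con; _:+_; _:*_; _:-_; :-_)
open ≡-Reasoning

-- Finite sums, signs and partial fractions

-- All rearrangements are exact identities between finite sums up to N; the limit is taken only at
-- the end, so no interchange of infinite sums occurs. The price is truncation errors, and A(N)
-- itself, which diverges when its sign is +1. In the sums over k and l, A(N) occurs only with the
-- coefficient 1 - αⁿ: this is 0 for α = 1, and for α = -1 the sequence A(N) tends to -ln 2. The
-- errors are bounded by a power of H(N) times n/N; against weights of size at most 1/n² and factors
-- bounded by powers of H(N) they add up to O(H(N)ᵖ/N), which vanishes. The bracket in T has two
-- parts for two reasons. The partial fractions of 1/(k(n-k)) and of 1/(k(n+k)) both produce
-- αⁿA(n)/n, so the wanted term is obtained twice instead of cancelling. And in the sum over n the
-- two parts of g(n,k), which is 2k/(n²-k²) for n ≠ k, contribute opposite multiples of Σ_{j≤k}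
-- γʲ/j; so no such factor is left to turn the other side into quadratic sums again.

∑< : ℕ → (ℕ → ℚ) → ℚ
∑< zero    f = 0ℚ
∑< (suc n) f = ∑< n f + f n

∑≡∑< : (f : (j : ℕ) .{{_ : NonZero j}} → ℚ) → ∀ n → ∑ n f ≡ ∑< n (λ i → f (suc i))
∑≡∑< f zero    = refl
∑≡∑< f (suc n) = cong (_+ f (suc n)) (∑≡∑< f n)

∑<-cong : ∀ n {f g : ℕ → ℚ} → (∀ i → i ℕ.< n → f i ≡ g i) → ∑< n f ≡ ∑< n g
∑<-cong zero    h = refl
∑<-cong (suc n) h = cong₂ _+_ (∑<-cong n λ i i<n → h i (ℕ.m≤n⇒m≤1+n i<n)) (h n ℕ.≤-refl)

∑<-ext : ∀ n {f g : ℕ → ℚ} → (∀ i → f i ≡ g i) → ∑< n f ≡ ∑< n g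
∑<-ext n h = ∑<-cong n λ i _ → h i

∑<-+ : ∀ n (f g : ℕ → ℚ) → ∑< n (λ i → f i + g i) ≡ ∑< n f + ∑< n g
∑<-+ zero    f g = refl
∑<-+ (suc n) f g = trans (cong (_+ (f n + g n)) (∑<-+ n f g))
  (solve 4 (λ a b c d → (a :+ b) :+ (c :+ d) := (a :+ c) :+ (b :+ d)) refl
    (∑< n f) (∑< n g) (f n) (g n))

∑<-*ˡ : ∀ n c (f : ℕ → ℚ) → ∑< n (λ i → c * f i) ≡ c * ∑< n f
∑<-*ˡ zero    c f = sym (*-zeroʳ c)
∑<-*ˡ (suc n) c f = trans (cong (_+ c * f n) (∑<-*ˡ n c f)) (sym (*-distribˡ-+ c (∑< n f) (f n)))

∑<-neg : ∀ n (f : ℕ → ℚ) → ∑< n (λ i → - f i) ≡ - ∑< n f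
∑<-neg zero    f = refl
∑<-neg (suc n) f = trans (cong (_+ - f n) (∑<-neg n f)) (sym (neg-distrib-+ (∑< n f) (f n)))

∑<-zero : ∀ n → ∑< n (λ _ → 0ℚ) ≡ 0ℚ
∑<-zero zero    = refl
∑<-zero (suc n) = trans (+-identityʳ _) (∑<-zero n)

∑<-swap : ∀ m n (f : ℕ → ℕ → ℚ) → ∑< m (λ i → ∑< n (f i)) ≡ ∑< n (λ j → ∑< m (λ i → f i j))
∑<-swap zero    n f = sym (∑<-zero n)
∑<-swap (suc m) n f = trans (cong (_+ ∑< n (f m)) (∑<-swap m n f))
  (sym (∑<-+ n (λ j → ∑< m (λ i → f i j)) (f m)))

∑<-front : ∀ n (f : ℕ → ℚ) → ∑< (suc n) f ≡ f 0 + ∑< n (λ i → f (suc i))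
∑<-front zero    f = +-comm 0ℚ (f 0)
∑<-front (suc n) f = trans (cong (_+ f (suc n)) (∑<-front n f)) (+-assoc (f 0) _ (f (suc n)))

∑<-append : ∀ m n (f : ℕ → ℚ) → ∑< (m ℕ.+ n) f ≡ ∑< m f + ∑< n (λ i → f (m ℕ.+ i))
∑<-append zero    n f = sym (+-identityˡ _)
∑<-append (suc m) n f = begin
  ∑< (suc m ℕ.+ n) f                                        ≡⟨ ∑<-front (m ℕ.+ n) f ⟩
  f 0 + ∑< (m ℕ.+ n) (λ i → f (suc i))                      ≡⟨ cong (λ z → f 0 + z) (∑<-append m n (λ i → f (suc i))) ⟩
  f 0 + (∑< m (λ i → f (suc i)) + t)                        ≡⟨ sym (+-assoc (f 0) _ t) ⟩
  (f 0 + ∑< m (λ i → f (suc i))) + t                        ≡⟨ cong (_+ t) (sym (∑<-front m f)) ⟩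
  ∑< (suc m) f + t                                          ∎
  where t = ∑< n (λ i → f (suc m ℕ.+ i))

∑<-*-∑< : ∀ m n (f g : ℕ → ℚ) → ∑< m f * ∑< n g ≡ ∑< m (λ i → ∑< n (λ j → f i * g j))
∑<-*-∑< m n f g = sym (begin
  ∑< m (λ i → ∑< n (λ j → f i * g j)) ≡⟨ ∑<-ext m (λ i → trans (∑<-*ˡ n (f i) g) (*-comm (f i) (∑< n g))) ⟩
  ∑< m (λ i → ∑< n g * f i)           ≡⟨ ∑<-*ˡ m (∑< n g) f ⟩
  ∑< n g * ∑< m f                     ≡⟨ *-comm (∑< n g) (∑< m f) ⟩
  ∑< m f * ∑< n g                     ∎)

infixr 8 _^^_

_^^_ : ℚ → ℕ → ℚ
x ^^ zero  = 1ℚ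
x ^^ suc n = x * x ^^ n

rpow : ∀ i q → 1/ suc i ^ q ≡ r i ^^ q
rpow i zero    = refl
rpow i (suc q) = trans (eq (suc i ℕ.^ q) {{ℕ.m^n≢0 (suc i) q}} {{ℕ.m^n≢0 (suc i) (suc q)}}) (cong (r i *_) (rpow i q))
  where
  eq : ∀ k .{{_ : NonZero k}} .{{_ : NonZero (suc i ℕ.* k)}} →
    _/_ (+ 1) (suc i ℕ.* k) ≡ r i * (+ 1 / k)
  eq (suc k) = recip-* i k

-- The sign (±1)ⁿ, with true for −1.
pw : Bool → ℕ → ℚ
pw false n       = 1ℚ
pw true  zero    = 1ℚ
pw true  (suc n) = - pw true n

-- A summation index i stands for n = i + 1.
ch : Bool → ℕ → ℚ
ch b i = pw b (suc i)

pw-+ : ∀ b m n → pw b (m ℕ.+ n) ≡ pw b m * pw b n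
pw-+ false m       n = refl
pw-+ true  zero    n = sym (*-identityˡ (pw true n))
pw-+ true  (suc m) n = trans (cong -_ (pw-+ true m n)) (neg-distribˡ-* (pw true m) (pw true n))

pw-xor : ∀ a b n → pw a n * pw b n ≡ pw (a xor b) n
pw-xor false b     n       = *-identityˡ (pw b n)
pw-xor true  false n       = *-identityʳ (pw true n)
pw-xor true  true  zero    = refl
pw-xor true  true  (suc n) = trans
  (solve 2 (λ x y → (:- x) :* (:- y) := x :* y) refl (pw true n) (pw true n))
  (pw-xor true true n)

xor-self : ∀ b → b xor b ≡ false
xor-self false = refl
xor-self true  = refl

pw² : ∀ b n → pw b n * pw b n ≡ 1ℚ
pw² b n = trans (pw-xor b b n) (cong (λ c → pw c n) (xor-self b))

-- For `false` this is ζ_n(p). For `true` it is -L_n(p), because `ch` carries (-1)ⁿ where L carries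
-- (-1)ⁿ⁻¹.
A : Bool → ℕ → ℕ → ℚ
A b p n = ∑< n (λ j → ch b j * r j ^^ p)

-- D n k = 1/(n − k), with the junk value 0 on the diagonal.
D : ℕ → ℕ → ℚ
D zero    zero    = 0ℚ
D zero    (suc k) = - r k
D (suc n) zero    = r n
D (suc n) (suc k) = D n k

-- 1/((n + 1) + (k + 1))
E : ℕ → ℕ → ℚ
E n k = r (suc n ℕ.+ k)

-- The kernel called g(n,k) in the overview; below, `g` denotes its weighted sum over n.
G : ℕ → ℕ → ℚ
G n k = D n k - E n k

-- Rational-valued, so that coincidences of indices enter the identities as summands that can be
-- summed, and not as case distinctions.
δ : ℕ → ℕ → ℚ
δ zero    zero    = 1ℚ
δ zero    (suc k) = 0ℚ
δ (suc n) zero    = 0ℚ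
δ (suc n) (suc k) = δ n k

δ-subst : ∀ (f : ℕ → ℚ) n k → δ n k * f n ≡ δ n k * f k
δ-subst f zero    zero    = refl
δ-subst f zero    (suc k) = trans (*-zeroˡ (f 0)) (sym (*-zeroˡ (f (suc k))))
δ-subst f (suc n) zero    = trans (*-zeroˡ (f (suc n))) (sym (*-zeroˡ (f 0)))
δ-subst f (suc n) (suc k) = δ-subst (λ i → f (suc i)) n k

δ-sym : ∀ n k → δ n k ≡ δ k n
δ-sym zero    zero    = refl
δ-sym zero    (suc k) = refl
δ-sym (suc n) zero    = refl
δ-sym (suc n) (suc k) = δ-sym n k

∑<-δ-out : ∀ N n (f : ℕ → ℚ) → N ℕ.≤ n → ∑< N (λ k → δ n k * f k) ≡ 0ℚ
∑<-δ-out zero    n       f h       = refl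
∑<-δ-out (suc N) (suc n) f (s≤s h) = begin
  ∑< (suc N) (λ k → δ (suc n) k * f k)             ≡⟨ ∑<-front N _ ⟩
  0ℚ * f 0 + ∑< N (λ k → δ n k * f (suc k))        ≡⟨ cong₂ _+_ (*-zeroˡ (f 0)) (∑<-δ-out N n (λ k → f (suc k)) h) ⟩
  0ℚ                                               ∎

∑<-δ : ∀ N n (f : ℕ → ℚ) → n ℕ.< N → ∑< N (λ k → δ n k * f k) ≡ f n
∑<-δ (suc N) zero f _ = begin
  ∑< (suc N) (λ k → δ 0 k * f k)                   ≡⟨ ∑<-front N _ ⟩
  1ℚ * f 0 + ∑< N (λ k → 0ℚ * f (suc k))           ≡⟨ cong₂ _+_ (*-identityˡ (f 0)) (trans (∑<-ext N (λ k → *-zeroˡ (f (suc k)))) (∑<-zero N)) ⟩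
  f 0 + 0ℚ                                         ≡⟨ +-identityʳ (f 0) ⟩
  f 0                                              ∎
∑<-δ (suc N) (suc n) f (s≤s h) = begin
  ∑< (suc N) (λ k → δ (suc n) k * f k)             ≡⟨ ∑<-front N _ ⟩
  0ℚ * f 0 + ∑< N (λ k → δ n k * f (suc k))        ≡⟨ cong₂ _+_ (*-zeroˡ (f 0)) (∑<-δ N n (λ k → f (suc k)) h) ⟩
  0ℚ + f (suc n)                                   ≡⟨ +-identityˡ (f (suc n)) ⟩
  f (suc n)                                        ∎

D-antisym : ∀ n k → D n k ≡ - D k n
D-antisym zero    zero    = refl
D-antisym zero    (suc k) = refl
D-antisym (suc n) zero    = solve 1 (λ x → x := :- (:- x)) refl (r n)
D-antisym (suc n) (suc k) = D-antisym n k

δ*D : ∀ n k → δ n k * D n k ≡ 0ℚ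
δ*D zero    zero    = refl
δ*D zero    (suc k) = *-zeroˡ (- r k)
δ*D (suc n) zero    = *-zeroˡ (r n)
δ*D (suc n) (suc k) = δ*D n k

E-sym : ∀ n k → E n k ≡ E k n
E-sym n k = cong (λ i → r (suc i)) (ℕ.+-comm n k)

-- A difference is unchanged when both indices are shifted, so the recursion of `D` applies. The
-- term with `δ` records the junk value on the diagonal; the partial fractions below derive from
-- this equation and `E-recip`.
D-recip : ∀ n k → (ι (suc n) - ι (suc k)) * D n k ≡ 1ℚ - δ n k
D-recip n k = trans
  (cong (_* D n k) (trans (cong₂ _-_ (ι-suc n) (ι-suc k))
    (solve 2 (λ x y → (x :+ con 1ℚ) :- (y :+ con 1ℚ) := x :- y) refl (ι n) (ι k))))
  (go n k)
  where
  go : ∀ n k → (ι n - ι k) * D n k ≡ 1ℚ - δ n k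
  go zero    zero    = refl
  go zero    (suc k) = trans
    (solve 2 (λ x y → (con 0ℚ :- x) :* (:- y) := x :* y) refl (ι (suc k)) (r k)) (ι*r k)
  go (suc n) zero    = trans
    (solve 2 (λ x y → (x :- con 0ℚ) :* y := x :* y) refl (ι (suc n)) (r n)) (ι*r n)
  go (suc n) (suc k) = D-recip n k

E-recip : ∀ n k → (ι (suc n) + ι (suc k)) * E n k ≡ 1ℚ
E-recip n k = trans (cong (_* E n k)
  (trans (sym (ι-+ (suc n) (suc k))) (cong (λ i → ι (suc i)) (ℕ.+-suc n k)))) (ι*r (suc n ℕ.+ k))

-- Reciprocals are abstracted to variables subject to x·a = 1; after a factor y·b = 1 is inserted,
-- the identity is ring algebra. `D-split` and `DD+EE` are proved the same way.
E-split : ∀ n k → r n * E n k ≡ r k * (r n - E n k)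
E-split n k = go (ι (suc n)) (ι (suc k)) (r n) (r k) (E n k) (ι*r n) (ι*r k) (E-recip n k)
  where
  go : ∀ x y a b e → x * a ≡ 1ℚ → y * b ≡ 1ℚ → (x + y) * e ≡ 1ℚ → a * e ≡ b * (a - e)
  go x y a b e ha hb he = begin
    a * e                                    ≡⟨ sym (*-identityʳ (a * e)) ⟩
    a * e * 1ℚ                               ≡⟨ cong (a * e *_) (sym hb) ⟩
    a * e * (y * b)                          ≡⟨ solve 5 (λ x y a b e → a :* e :* (y :* b)
                                                 := b :* (a :* ((x :+ y) :* e) :- e :* (x :* a))) refl x y a b e ⟩
    b * (a * ((x + y) * e) - e * (x * a))    ≡⟨ cong₂ (λ u v → b * (a * u - e * v)) he ha ⟩
    b * (a * 1ℚ - e * 1ℚ)                    ≡⟨ cong₂ (λ u v → b * (u - v)) (*-identityʳ a) (*-identityʳ e) ⟩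
    b * (a - e)                              ∎

D-split : ∀ n k → r n * D n k ≡ r k * (D n k - r n) + δ n k * (r k * r k)
D-split n k = go (ι (suc n)) (ι (suc k)) (r n) (r k) (D n k) (δ n k)
  (ι*r n) (ι*r k) (D-recip n k) (δ-subst r n k)
  where
  go : ∀ x y a b d e → x * a ≡ 1ℚ → y * b ≡ 1ℚ → (x - y) * d ≡ 1ℚ - e → e * a ≡ e * b →
    a * d ≡ b * (d - a) + e * (b * b)
  go x y a b d e ha hb hd he = begin
    a * d                                    ≡⟨ sym (*-identityʳ (a * d)) ⟩
    a * d * 1ℚ                               ≡⟨ cong (a * d *_) (sym hb) ⟩
    a * d * (y * b)                          ≡⟨ solve 5 (λ x y a b d → a :* d :* (y :* b)
                                                 := b :* (d :* (x :* a) :- a :* ((x :- y) :* d))) refl x y a b d ⟩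
    b * (d * (x * a) - a * ((x - y) * d))    ≡⟨ cong₂ (λ u v → b * (d * u - a * v)) ha hd ⟩
    b * (d * 1ℚ - a * (1ℚ - e))              ≡⟨ solve 4 (λ a b d e → b :* (d :* con 1ℚ :- a :* (con 1ℚ :- e))
                                                 := b :* (d :- a) :+ (e :* a) :* b) refl a b d e ⟩
    b * (d - a) + (e * a) * b                ≡⟨ cong (λ z → b * (d - a) + z * b) he ⟩
    b * (d - a) + (e * b) * b                ≡⟨ cong (λ z → b * (d - a) + z) (*-assoc e b b) ⟩
    b * (d - a) + e * (b * b)                ∎

-- The partial fractions 1/((n−k)(n−l)) = (1/(k−l)) (1/(n−k) − 1/(n−l)) and its analogue for
-- n+k, n+l, added; the terms with δ correct the coincidences of indices.
DD+EE : ∀ n k l → D n k * D n l + E n k * E n l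
  ≡ D k l * (G n k - G n l) + δ n k * (D k l * D k l) + δ n l * (D k l * D k l)
    + δ k l * (D n k * D n l + E n k * E n l)
DD+EE n k l = go (ι (suc n)) (ι (suc k)) (ι (suc l)) (D n k) (D n l) (D k l) (E n k) (E n l)
  (δ n k) (δ n l) (δ k l)
  (D-recip n k) (D-recip n l) (D-recip k l) (E-recip n k) (E-recip n l)
  (trans (δ-subst (λ i → D i k) n l) (cong (δ n l *_) (D-antisym l k)))
  (δ-subst (λ i → D i l) n k)
  where
  go : ∀ x y z a b c e f d₁ d₂ d₃ → (x - y) * a ≡ 1ℚ - d₁ → (x - z) * b ≡ 1ℚ - d₂ →
    (y - z) * c ≡ 1ℚ - d₃ → (x + y) * e ≡ 1ℚ → (x + z) * f ≡ 1ℚ →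
    d₂ * a ≡ d₂ * - c → d₁ * b ≡ d₁ * c →
    a * b + e * f ≡ c * ((a - e) - (b - f)) + d₁ * (c * c) + d₂ * (c * c) + d₃ * (a * b + e * f)
  go x y z a b c e f d₁ d₂ d₃ ha hb hc he hf h₂ h₁ = begin
    a * b + e * f
      -- `D-recip` turns (k - l)/(k - l) into 1 - `δ k l` only; the missing `δ k l` multiple of the
      -- left side is set aside as `t`.
      ≡⟨ solve 2 (λ p d → p := (con 1ℚ :- d) :* p :+ d :* p) refl (a * b + e * f) d₃ ⟩
    (1ℚ - d₃) * (a * b + e * f) + t
      ≡⟨ cong (λ w → w * (a * b + e * f) + t) (sym hc) ⟩
    (y - z) * c * (a * b + e * f) + t
      ≡⟨ cong (_+ t) (solve 8 (λ x y z a b c e f → (y :- z) :* c :* (a :* b :+ e :* f)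
           := c :* ((a :* ((x :- z) :* b) :- b :* ((x :- y) :* a))
                    :+ (f :* ((x :+ y) :* e) :- e :* ((x :+ z) :* f)))) refl x y z a b c e f) ⟩
    c * ((a * ((x - z) * b) - b * ((x - y) * a)) + (f * ((x + y) * e) - e * ((x + z) * f))) + t
      ≡⟨ cong₂ (λ u v → c * (u + v) + t)
           (cong₂ (λ u v → a * u - b * v) hb ha) (cong₂ (λ u v → f * u - e * v) he hf) ⟩
    c * ((a * (1ℚ - d₂) - b * (1ℚ - d₁)) + (f * 1ℚ - e * 1ℚ)) + t
      ≡⟨ cong (_+ t) (solve 7 (λ a b c e f d₁ d₂ →
           c :* ((a :* (con 1ℚ :- d₂) :- b :* (con 1ℚ :- d₁)) :+ (f :* con 1ℚ :- e :* con 1ℚ))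
           := c :* ((a :- e) :- (b :- f)) :+ c :* (d₁ :* b) :- c :* (d₂ :* a))
           refl a b c e f d₁ d₂) ⟩
    c * ((a - e) - (b - f)) + c * (d₁ * b) - c * (d₂ * a) + t
      ≡⟨ cong₂ (λ u v → c * ((a - e) - (b - f)) + c * u - c * v + t) h₁ h₂ ⟩
    c * ((a - e) - (b - f)) + c * (d₁ * c) - c * (d₂ * - c) + t
      ≡⟨ cong (_+ t) (solve 4 (λ s c d₁ d₂ → s :+ c :* (d₁ :* c) :- c :* (d₂ :* (:- c))
           := s :+ d₁ :* (c :* c) :+ d₂ :* (c :* c)) refl (c * ((a - e) - (b - f))) c d₁ d₂) ⟩
    c * ((a - e) - (b - f)) + d₁ * (c * c) + d₂ * (c * c) + t ∎
    where t = d₃ * (a * b + e * f)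

-- The triple sum

∑³ : ℕ → (ℕ → ℕ → ℕ → ℚ) → ℚ
∑³ N f = ∑< N λ n → ∑< N λ k → ∑< N λ l → f n k l

∑³-ext : ∀ N {f g : ℕ → ℕ → ℕ → ℚ} → (∀ n k l → f n k l ≡ g n k l) → ∑³ N f ≡ ∑³ N g
∑³-ext N h = ∑<-ext N λ n → ∑<-ext N λ k → ∑<-ext N λ l → h n k l

∑³-+ : ∀ N (f g : ℕ → ℕ → ℕ → ℚ) → ∑³ N (λ n k l → f n k l + g n k l) ≡ ∑³ N f + ∑³ N g
∑³-+ N f g = trans
  (∑<-ext N λ n → trans (∑<-ext N λ k → ∑<-+ N (f n k) (g n k))
    (∑<-+ N (λ k → ∑< N (f n k)) (λ k → ∑< N (g n k))))
  (∑<-+ N (λ n → ∑< N λ k → ∑< N (f n k)) (λ n → ∑< N λ k → ∑< N (g n k)))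

∑³-swap : ∀ N (f : ℕ → ℕ → ℕ → ℚ) → ∑³ N f ≡ ∑³ N (λ n l k → f n k l)
∑³-swap N f = ∑<-ext N λ n → ∑<-swap N N (f n)

-- The identity holds for every N and arbitrary weights; signs and powers are put in only when the
-- inner sums are evaluated.
module TripleSum (N : ℕ) (w : ℕ → ℚ) where

  g : ℕ → ℚ
  g k = ∑< N λ n → w n * G n k

  Ds Es D²s : (ℕ → ℚ) → ℕ → ℚ
  Ds  u n = ∑< N λ k → u k * D n k
  Es  u n = ∑< N λ k → u k * E n k
  D²s u n = ∑< N λ k → u k * (D n k * D n k)

  P : ℕ → ℕ → ℕ → ℚ
  P n k l = D n k * D n l + E n k * E n l

  ∑³-g : ∀ (u v : ℕ → ℚ) → ∑³ N (λ n k l → u k * ((v l * D k l) * (w n * G n k)))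
    ≡ ∑< N (λ k → u k * (Ds v k * g k))
  ∑³-g u v = begin
    ∑³ N (λ n k l → u k * ((v l * D k l) * (w n * G n k)))
      ≡⟨ (∑<-ext N λ n → ∑<-ext N λ k → inner n k) ⟩
    ∑< N (λ n → ∑< N (λ k → u k * Ds v k * (w n * G n k)))
      ≡⟨ ∑<-swap N N (λ n k → u k * Ds v k * (w n * G n k)) ⟩
    ∑< N (λ k → ∑< N (λ n → u k * Ds v k * (w n * G n k)))
      ≡⟨ (∑<-ext N λ k → trans (∑<-*ˡ N (u k * Ds v k) (λ n → w n * G n k))
           (*-assoc (u k) (Ds v k) (g k))) ⟩
    ∑< N (λ k → u k * (Ds v k * g k)) ∎
    where
    inner : ∀ n k → ∑< N (λ l → u k * ((v l * D k l) * (w n * G n k)))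
      ≡ u k * Ds v k * (w n * G n k)
    inner n k = trans
      (∑<-ext N λ l → solve 3 (λ a b c → a :* (b :* c) := (a :* c) :* b) refl
        (u k) (v l * D k l) (w n * G n k))
      (trans (∑<-*ˡ N (u k * (w n * G n k)) (λ l → v l * D k l))
        (solve 3 (λ a b c → (a :* c) :* b := a :* b :* c) refl (u k) (Ds v k) (w n * G n k)))

  ∑³-δ : ∀ (u v : ℕ → ℚ) → ∑³ N (λ n k l → δ n k * (w n * u k * (v l * (D k l * D k l))))
    ≡ ∑< N (λ n → w n * u n * D²s v n)
  ∑³-δ u v = ∑<-cong N λ n n<N → trans
    (∑<-ext N λ k → trans (∑<-*ˡ N (δ n k) (λ l → w n * u k * (v l * (D k l * D k l))))
      (cong (δ n k *_) (∑<-*ˡ N (w n * u k) (λ l → v l * (D k l * D k l)))))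
    (∑<-δ N n (λ k → w n * u k * D²s v k) n<N)

  ∑³-diagonal : ∀ (u v : ℕ → ℚ) → ∑³ N (λ n k l → δ k l * (w n * (u k * v l * P n k l)))
    ≡ ∑< N (λ n → w n * ∑< N (λ k → u k * v k * (D n k * D n k + E n k * E n k)))
  ∑³-diagonal u v = ∑<-ext N λ n → trans
    (∑<-cong N λ k k<N → ∑<-δ N k (λ l → w n * (u k * v l * P n k l)) k<N)
    (∑<-*ˡ N (w n) (λ k → u k * v k * P n k k))

  expand : ∀ (u v : ℕ → ℚ) → ∑< N (λ n → w n * (Ds u n * Ds v n + Es u n * Es v n))
    ≡ ∑³ N (λ n k l → w n * (u k * v l * P n k l))
  expand u v = ∑<-ext N λ n → trans (cong (w n *_) (inner n)) (sym (trans
    (∑<-ext N λ k → ∑<-*ˡ N (w n) (λ l → u k * v l * P n k l))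
    (∑<-*ˡ N (w n) (λ k → ∑< N λ l → u k * v l * P n k l))))
    where
    inner : ∀ n → Ds u n * Ds v n + Es u n * Es v n ≡ ∑< N (λ k → ∑< N λ l → u k * v l * P n k l)
    inner n = trans
      (cong₂ _+_ (∑<-*-∑< N N (λ k → u k * D n k) (λ l → v l * D n l))
                 (∑<-*-∑< N N (λ k → u k * E n k) (λ l → v l * E n l)))
      (trans (sym (∑<-+ N _ _)) (∑<-ext N λ k → trans (sym (∑<-+ N _ _))
        (∑<-ext N λ l → solve 6 (λ u v a b c d → (u :* a) :* (v :* b) :+ (u :* c) :* (v :* d)
            := u :* v :* (a :* b :+ c :* d)) refl (u k) (v l) (D n k) (D n l) (E n k) (E n l))))

  -- The contributions of l are written with `D l k`, that is -`D k l`, so that the second and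
  -- fourth terms are the first and third with (u, k) and (v, l) exchanged, and one evaluation
  -- serves both.
  pointwise : ∀ (u v : ℕ → ℚ) n k l → w n * (u k * v l * P n k l)
    ≡ (((u k * ((v l * D k l) * (w n * G n k)) + v l * ((u k * D l k) * (w n * G n l)))
        + δ n k * (w n * u k * (v l * (D k l * D k l))))
        + δ n l * (w n * v l * (u k * (D l k * D l k))))
      + δ k l * (w n * (u k * v l * P n k l))
  pointwise u v n k l = trans (cong (λ z → w n * (u k * v l * z)) (DD+EE n k l))
    (trans
      (solve 9 (λ w u v c x y d e f → w :* (u :* v :* (c :* (x :- y) :+ d :* (c :* c) :+ e :* (c :* c) :+ f))
         := ((u :* ((v :* c) :* (w :* x)) :+ v :* ((u :* (:- c)) :* (w :* y)))
            :+ d :* (w :* u :* (v :* (c :* c))))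
            :+ e :* (w :* v :* (u :* ((:- c) :* (:- c))))
            :+ w :* (u :* v :* f)) refl
         (w n) (u k) (v l) (D k l) (G n k) (G n l) (δ n k) (δ n l) (δ k l * P n k l))
      (cong₂ (λ c t → (((u k * ((v l * D k l) * (w n * G n k)) + v l * ((u k * c) * (w n * G n l)))
          + δ n k * (w n * u k * (v l * (D k l * D k l))))
          + δ n l * (w n * v l * (u k * (c * c)))) + t)
        (sym (D-antisym l k))
        (solve 4 (λ w x f p → w :* (x :* (f :* p)) := f :* (w :* (x :* p))) refl
          (w n) (u k * v l) (δ k l) (P n k l))))

  triple-sum : ∀ (u v : ℕ → ℚ) → ∑< N (λ n → w n * (Ds u n * Ds v n + Es u n * Es v n))
    ≡ (((∑< N (λ k → u k * (Ds v k * g k)) + ∑< N (λ k → v k * (Ds u k * g k)))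
        + ∑< N (λ n → w n * u n * D²s v n))
        + ∑< N (λ n → w n * v n * D²s u n))
      + ∑< N (λ n → w n * ∑< N (λ k → u k * v k * (D n k * D n k + E n k * E n k)))
  triple-sum u v = begin
    ∑< N (λ n → w n * (Ds u n * Ds v n + Es u n * Es v n)) ≡⟨ expand u v ⟩
    ∑³ N (λ n k l → w n * (u k * v l * P n k l))           ≡⟨ ∑³-ext N (pointwise u v) ⟩
    ∑³ N _                                                 ≡⟨ ∑³-+ N _ F₅ ⟩
    ∑³ N _ + ∑³ N F₅                                       ≡⟨ cong (_+ ∑³ N F₅) (∑³-+ N _ F₄) ⟩
    (∑³ N _ + ∑³ N F₄) + ∑³ N F₅                           ≡⟨ cong (λ z → (z + ∑³ N F₄) + ∑³ N F₅) (∑³-+ N _ F₃) ⟩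
    ((∑³ N _ + ∑³ N F₃) + ∑³ N F₄) + ∑³ N F₅               ≡⟨ cong (λ z → ((z + ∑³ N F₃) + ∑³ N F₄) + ∑³ N F₅) (∑³-+ N F₁ F₂) ⟩
    (((∑³ N F₁ + ∑³ N F₂) + ∑³ N F₃) + ∑³ N F₄) + ∑³ N F₅  ≡⟨ cong₂ _+_ (cong₂ _+_ (cong₂ _+_ (cong₂ _+_
                                                                (∑³-g u v)
                                                                (trans (∑³-swap N F₂) (∑³-g v u)))
                                                                (∑³-δ u v))
                                                                (trans (∑³-swap N F₄) (∑³-δ v u)))
                                                                (∑³-diagonal u v) ⟩
    _ ∎
    where
    F₁ F₂ F₃ F₄ F₅ : ℕ → ℕ → ℕ → ℚ
    F₁ n k l = u k * ((v l * D k l) * (w n * G n k))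
    F₂ n k l = v l * ((u k * D l k) * (w n * G n l))
    F₃ n k l = δ n k * (w n * u k * (v l * (D k l * D k l)))
    F₄ n k l = δ n l * (w n * v l * (u k * (D l k * D l k)))
    F₅ n k l = δ k l * (w n * (u k * v l * P n k l))

-- Closed forms of the inner sums

-- Split at k = i: the distances to the left are 1 to i, those to the right 1 to m, and the sign of
-- k is the sign of i times that of the distance. The diagonal holds the junk value 0, which `φ`
-- must kill; `φ` will be the identity or the square.
∑D-φ : (φ : ℚ → ℚ) → φ 0ℚ ≡ 0ℚ → ∀ b i m → ∑< (i ℕ.+ suc m) (λ k → ch b k * φ (D i k))
  ≡ ch b i * (∑< i (λ j → ch b j * φ (r j)) + ∑< m (λ j → ch b j * φ (- r j)))
∑D-φ φ φ0 b zero m = begin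
  ∑< (suc m) (λ k → ch b k * φ (D 0 k))
    ≡⟨ ∑<-front m (λ k → ch b k * φ (D 0 k)) ⟩
  ch b 0 * φ 0ℚ + ∑< m (λ j → ch b (suc j) * φ (- r j))
    ≡⟨ cong₂ _+_ (trans (cong (ch b 0 *_) φ0) (*-zeroʳ (ch b 0)))
         (trans (∑<-ext m (λ j → trans (cong (_* φ (- r j)) (pw-+ b 1 (suc j)))
                                       (*-assoc (ch b 0) (ch b j) (φ (- r j)))))
                (∑<-*ˡ m (ch b 0) (λ j → ch b j * φ (- r j)))) ⟩
  0ℚ + ch b 0 * ∑< m (λ j → ch b j * φ (- r j))
    ≡⟨ solve 2 (λ c s → con 0ℚ :+ c :* s := c :* (con 0ℚ :+ s)) refl (ch b 0) _ ⟩
  ch b 0 * (0ℚ + ∑< m (λ j → ch b j * φ (- r j))) ∎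
∑D-φ φ φ0 b (suc i) m = begin
  ∑< (suc (i ℕ.+ suc m)) (λ k → ch b k * φ (D (suc i) k))
    ≡⟨ ∑<-front (i ℕ.+ suc m) (λ k → ch b k * φ (D (suc i) k)) ⟩
  ch b 0 * φ (r i) + ∑< (i ℕ.+ suc m) (λ k → ch b (suc k) * φ (D i k))
    ≡⟨ cong (λ z → ch b 0 * φ (r i) + z)
         (trans (∑<-ext (i ℕ.+ suc m) (λ k → trans (cong (_* φ (D i k)) (pw-+ b 1 (suc k)))
                                       (*-assoc (ch b 0) (ch b k) (φ (D i k)))))
           (trans (∑<-*ˡ (i ℕ.+ suc m) (ch b 0) (λ k → ch b k * φ (D i k)))
             (cong (ch b 0 *_) (∑D-φ φ φ0 b i m)))) ⟩
  ch b 0 * φ (r i) + ch b 0 * (ch b i * (s + t))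
    ≡⟨ cong (λ z → z * φ (r i) + ch b 0 * (ch b i * (s + t)))
         (trans (sym (*-identityʳ (ch b 0))) (cong (ch b 0 *_) (sym (pw² b (suc i))))) ⟩
  ch b 0 * (ch b i * ch b i) * φ (r i) + ch b 0 * (ch b i * (s + t))
    ≡⟨ solve 5 (λ c d x s t → c :* (d :* d) :* x :+ c :* (d :* (s :+ t))
         := (c :* d) :* ((s :+ d :* x) :+ t)) refl (ch b 0) (ch b i) (φ (r i)) s t ⟩
  (ch b 0 * ch b i) * ((s + ch b i * φ (r i)) + t)
    ≡⟨ cong (_* ((s + ch b i * φ (r i)) + t)) (sym (pw-+ b 1 (suc i))) ⟩
  ch b (suc i) * ((s + ch b i * φ (r i)) + t) ∎
  where
  s = ∑< i (λ j → ch b j * φ (r j))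
  t = ∑< m (λ j → ch b j * φ (- r j))

private
  split-index : ∀ {N i} → i ℕ.< N → i ℕ.+ suc (N ∸ suc i) ≡ N
  split-index {N} {i} i<N = trans (ℕ.+-suc i (N ∸ suc i)) (ℕ.m+[n∸m]≡n i<N)

  pow1 : ∀ b n → ∑< n (λ j → ch b j * r j) ≡ A b 1 n
  pow1 b n = ∑<-ext n λ j → cong (ch b j *_) (sym (*-identityʳ (r j)))

  pow2 : ∀ b n → ∑< n (λ j → ch b j * (r j * r j)) ≡ A b 2 n
  pow2 b n = ∑<-ext n λ j → cong (λ z → ch b j * (r j * z)) (sym (*-identityʳ (r j)))

∑D : ∀ b {N i} → i ℕ.< N → ∑< N (λ k → ch b k * D i k) ≡ ch b i * (A b 1 i - A b 1 (N ∸ suc i))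
∑D b {N} {i} i<N = trans (cong (λ M → ∑< M (λ k → ch b k * D i k)) (sym (split-index i<N)))
  (trans (∑D-φ (λ x → x) refl b i (N ∸ suc i))
    (cong (ch b i *_) (cong₂ _+_ (pow1 b i)
      (trans (∑<-ext (N ∸ suc i) (λ j → sym (neg-distribʳ-* (ch b j) (r j))))
        (trans (∑<-neg (N ∸ suc i) (λ j → ch b j * r j)) (cong -_ (pow1 b (N ∸ suc i))))))))

∑D² : ∀ b {N i} → i ℕ.< N →
  ∑< N (λ k → ch b k * (D i k * D i k)) ≡ ch b i * (A b 2 i + A b 2 (N ∸ suc i))
∑D² b {N} {i} i<N = trans (cong (λ M → ∑< M (λ k → ch b k * (D i k * D i k))) (sym (split-index i<N)))
  (trans (∑D-φ (λ x → x * x) refl b i (N ∸ suc i))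
    (cong (ch b i *_) (cong₂ _+_ (pow2 b i)
      (trans (∑<-ext (N ∸ suc i) (λ j → cong (ch b j *_)
          (solve 1 (λ x → (:- x) :* (:- x) := x :* x) refl (r j))))
        (pow2 b (N ∸ suc i))))))

-- The sums n + k fill the N places just after n, so a difference of two partial sums appears; the
-- sign of k is the product of the signs of n and n + k.
∑E-φ : (φ : ℚ → ℚ) → ∀ b N i → ∑< N (λ k → ch b k * φ (E i k))
  ≡ ch b i * (∑< (suc i ℕ.+ N) (λ j → ch b j * φ (r j)) - ∑< (suc i) (λ j → ch b j * φ (r j)))
∑E-φ φ b N i = begin
  ∑< N (λ k → ch b k * φ (E i k))
    ≡⟨ ∑<-ext N (λ k → trans (cong (_* φ (E i k)) (shift k)) (*-assoc (ch b i) (f (suc i ℕ.+ k)) (φ (E i k)))) ⟩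
  ∑< N (λ k → ch b i * (f (suc i ℕ.+ k) * φ (E i k)))
    ≡⟨ ∑<-*ˡ N (ch b i) (λ k → f (suc i ℕ.+ k) * φ (E i k)) ⟩
  ch b i * t
    ≡⟨ cong (ch b i *_) (solve 2 (λ s t → t := (s :+ t) :- s) refl s t) ⟩
  ch b i * ((s + t) - s)
    ≡⟨ cong (λ z → ch b i * (z - s)) (sym (∑<-append (suc i) N (λ j → ch b j * φ (r j)))) ⟩
  ch b i * (∑< (suc i ℕ.+ N) (λ j → ch b j * φ (r j)) - s) ∎
  where
  f : ℕ → ℚ
  f = ch b
  s = ∑< (suc i) (λ j → ch b j * φ (r j))
  t = ∑< N (λ k → f (suc i ℕ.+ k) * φ (E i k))
  shift : ∀ k → ch b k ≡ ch b i * f (suc i ℕ.+ k)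
  shift k = sym (trans (cong (ch b i *_) (trans (cong (pw b) (sym (ℕ.+-suc (suc i) k))) (pw-+ b (suc i) (suc k))))
    (trans (sym (*-assoc (ch b i) (ch b i) (ch b k)))
      (trans (cong (_* ch b k) (pw² b (suc i))) (*-identityˡ (ch b k)))))

∑E : ∀ b N i → ∑< N (λ k → ch b k * E i k) ≡ ch b i * (A b 1 (suc i ℕ.+ N) - A b 1 (suc i))
∑E b N i = trans (∑E-φ (λ x → x) b N i)
  (cong (ch b i *_) (cong₂ _-_ (pow1 b (suc i ℕ.+ N)) (pow1 b (suc i))))

∑E² : ∀ b N i →
  ∑< N (λ k → ch b k * (E i k * E i k)) ≡ ch b i * (A b 2 (suc i ℕ.+ N) - A b 2 (suc i))
∑E² b N i = trans (∑E-φ (λ x → x * x) b N i)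
  (cong (ch b i *_) (cong₂ _-_ (pow2 b (suc i ℕ.+ N)) (pow2 b (suc i))))

-- Truncation errors: both turn out to be O((1 + H N) n/N).
eD eE : Bool → ℕ → ℕ → ℕ → ℚ
eD b p N i = A b p N - A b p (N ∸ suc i)
eE b p N i = A b p (suc i ℕ.+ N) - A b p N

-- Splitting at the diagonal gives partial sums up to n - 1, while the linear sums contain those up
-- to n. The last term loses its sign because the sign is squared.
ch-A-pred : ∀ b p i → ch b i * A b p i ≡ ch b i * A b p (suc i) - r i ^^ p
ch-A-pred b p i = trans
  (solve 3 (λ c a x → c :* a := c :* (a :+ c :* x) :- (c :* c) :* x) refl (ch b i) (A b p i) (r i ^^ p))
  (cong (λ z → ch b i * A b p (suc i) - z)
    (trans (cong (_* r i ^^ p) (pw² b (suc i))) (*-identityˡ (r i ^^ p))))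

-- `VD` and `VE` are n times the truncated sums of bᵏ/(k(n-k)) and bᵏ/(k(n+k)). Both have the
-- leading term bⁿA(n); `λD` and `λE` are the remainders, and there `A b 1 N` comes with the factor
-- 1 - bⁿ, which removes the divergent H(N) when b is `false`.
λD λE VD VE : Bool → ℕ → ℕ → ℚ
λD b N i = (1ℚ - ch b i) * A b 1 N + ch b i * eD b 1 N i - (1ℚ + ch b i) * r i
λE b N i = (1ℚ - ch b i) * A b 1 N - ch b i * eE b 1 N i
VD b N i = ch b i * A b 1 (suc i) + λD b N i
VE b N i = ch b i * A b 1 (suc i) + λE b N i

-- `D-split` with the indices exchanged. At k = n the left side is the junk value 0, and the term
-- with `δ` takes away the 1/n² that the right side would otherwise keep.
r*D : ∀ i k → r k * D i k ≡ r i * (r k + D i k) - δ i k * (r i * r i)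
r*D i k = begin
  r k * D i k                                     ≡⟨ cong (r k *_) (D-antisym i k) ⟩
  r k * - D k i                                   ≡⟨ sym (neg-distribʳ-* (r k) (D k i)) ⟩
  - (r k * D k i)                                 ≡⟨ cong -_ (D-split k i) ⟩
  - (r i * (D k i - r k) + δ k i * (r i * r i))   ≡⟨ solve 4 (λ a d b e → :- (a :* (d :- b) :+ e :* (a :* a))
                                                      := a :* (b :+ (:- d)) :- e :* (a :* a)) refl (r i) (D k i) (r k) (δ k i) ⟩
  r i * (r k + - D k i) - δ k i * (r i * r i)     ≡⟨ cong₂ (λ u v → r i * (r k + u) - v * (r i * r i))
                                                      (sym (D-antisym i k)) (δ-sym k i) ⟩
  r i * (r k + D i k) - δ i k * (r i * r i)       ∎

r*E : ∀ i k → r k * E i k ≡ r i * (r k - E i k)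
r*E i k = trans (cong (r k *_) (E-sym i k)) (trans (E-split k i) (cong (λ z → r i * (r k - z)) (E-sym k i)))

∑rD : ∀ b {N i} → i ℕ.< N → ∑< N (λ k → ch b k * r k * D i k) ≡ r i * VD b N i
∑rD b {N} {i} i<N = begin
  ∑< N (λ k → ch b k * r k * D i k)
    ≡⟨ ∑<-ext N (λ k → trans (*-assoc (ch b k) (r k) (D i k)) (trans (cong (ch b k *_) (r*D i k))
         (solve 5 (λ c a b d e → c :* (a :* (b :+ d) :- e :* (a :* a))
           := a :* (c :* b :+ c :* d) :+ e :* (:- (c :* (a :* a)))) refl (ch b k) (r i) (r k) (D i k) (δ i k)))) ⟩
  ∑< N (λ k → r i * (ch b k * r k + ch b k * D i k) + δ i k * - (ch b k * (r i * r i)))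
    ≡⟨ trans (∑<-+ N _ _) (cong₂ _+_ (trans (∑<-*ˡ N (r i) _) (cong (r i *_) (∑<-+ N _ _)))
         (∑<-δ N i (λ k → - (ch b k * (r i * r i))) i<N)) ⟩
  r i * (∑< N (λ k → ch b k * r k) + ∑< N (λ k → ch b k * D i k)) + - (ch b i * (r i * r i))
    ≡⟨ cong₂ (λ u v → r i * (u + v) + - (ch b i * (r i * r i))) (pow1 b N) (trans (∑D b i<N)
         (trans (*-distribˡ-+ (ch b i) (A b 1 i) (- A b 1 (N ∸ suc i))) (cong (_+ ch b i * - A b 1 (N ∸ suc i)) (ch-A-pred b 1 i)))) ⟩
  r i * (A b 1 N + (ch b i * A b 1 (suc i) - r i * 1ℚ + ch b i * - A b 1 (N ∸ suc i))) + - (ch b i * (r i * r i))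
    ≡⟨ solve 5 (λ x c a n m → x :* (n :+ (c :* a :- x :* con 1ℚ :+ c :* (:- m))) :+ (:- (c :* (x :* x)))
         := x :* (c :* a :+ ((con 1ℚ :- c) :* n :+ c :* (n :- m) :- (con 1ℚ :+ c) :* x))) refl
         (r i) (ch b i) (A b 1 (suc i)) (A b 1 N) (A b 1 (N ∸ suc i)) ⟩
  r i * VD b N i ∎

∑rE : ∀ b N i → ∑< N (λ k → ch b k * r k * E i k) ≡ r i * VE b N i
∑rE b N i = begin
  ∑< N (λ k → ch b k * r k * E i k)
    ≡⟨ ∑<-ext N (λ k → trans (*-assoc (ch b k) (r k) (E i k)) (trans (cong (ch b k *_) (r*E i k))
         (solve 4 (λ c a b d → c :* (a :* (b :- d)) := a :* (c :* b :+ (:- (c :* d)))) refl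
           (ch b k) (r i) (r k) (E i k)))) ⟩
  ∑< N (λ k → r i * (ch b k * r k + - (ch b k * E i k)))
    ≡⟨ trans (∑<-*ˡ N (r i) _) (cong (r i *_) (trans (∑<-+ N _ _)
         (cong₂ _+_ (pow1 b N) (trans (∑<-neg N _) (cong -_ (∑E b N i)))))) ⟩
  r i * (A b 1 N + - (ch b i * (A b 1 (suc i ℕ.+ N) - A b 1 (suc i))))
    ≡⟨ solve 5 (λ x c a n m → x :* (n :+ (:- (c :* (m :- a))))
         := x :* (c :* a :+ ((con 1ℚ :- c) :* n :- c :* (m :- n)))) refl
         (r i) (ch b i) (A b 1 (suc i)) (A b 1 N) (A b 1 (suc i ℕ.+ N)) ⟩
  r i * VE b N i ∎

D²-sum E²-sum : Bool → ℕ → ℕ → ℚ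
D²-sum b N i = ch b i * A b 2 (suc i) - r i * (r i * 1ℚ) + (ch b i * A b 2 N - ch b i * eD b 2 N i)
E²-sum b N i = ch b i * A b 2 N + ch b i * eE b 2 N i - ch b i * A b 2 (suc i)

∑D²≡ : ∀ b {N i} → i ℕ.< N → ∑< N (λ k → ch b k * (D i k * D i k)) ≡ D²-sum b N i
∑D²≡ b {N} {i} i<N = trans (∑D² b i<N)
  (trans (*-distribˡ-+ (ch b i) (A b 2 i) (A b 2 (N ∸ suc i)))
    (cong₂ _+_ (ch-A-pred b 2 i)
      (solve 3 (λ c n m → c :* m := c :* n :- c :* (n :- m)) refl (ch b i) (A b 2 N) (A b 2 (N ∸ suc i)))))

∑E²≡ : ∀ b N i → ∑< N (λ k → ch b k * (E i k * E i k)) ≡ E²-sum b N i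
∑E²≡ b N i = trans (∑E² b N i)
  (solve 4 (λ c n m a → c :* (m :- a) := c :* n :+ c :* (m :- n) :- c :* a) refl
    (ch b i) (A b 2 N) (A b 2 (suc i ℕ.+ N)) (A b 2 (suc i)))

-- No term with `δ` survives: one more factor `D` meets `δ*D`.
r*D² : ∀ i k → r k * (D i k * D i k) ≡ r i * (r k * D i k + D i k * D i k)
r*D² i k = begin
  r k * (D i k * D i k)                                            ≡⟨ sym (*-assoc (r k) (D i k) (D i k)) ⟩
  r k * D i k * D i k                                              ≡⟨ cong (_* D i k) (r*D i k) ⟩
  (r i * (r k + D i k) - δ i k * (r i * r i)) * D i k              ≡⟨ solve 4 (λ a b d e → (a :* (b :+ d) :- e :* (a :* a)) :* d
                                                                       := a :* (b :* d :+ d :* d) :- (e :* d) :* (a :* a)) refl (r i) (r k) (D i k) (δ i k) ⟩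
  r i * (r k * D i k + D i k * D i k) - δ i k * D i k * (r i * r i) ≡⟨ cong (λ z → r i * (r k * D i k + D i k * D i k) - z * (r i * r i)) (δ*D i k) ⟩
  r i * (r k * D i k + D i k * D i k) - 0ℚ * (r i * r i)           ≡⟨ solve 2 (λ s a → s :- con 0ℚ :* a := s) refl _ (r i * r i) ⟩
  r i * (r k * D i k + D i k * D i k)                              ∎

QL : Bool → ℕ → ℕ → ℚ
QL b N i = r i * VD b N i + D²-sum b N i

∑rD² : ∀ b {N i} → i ℕ.< N → ∑< N (λ k → ch b k * r k * (D i k * D i k)) ≡ r i * QL b N i
∑rD² b {N} {i} i<N = begin
  ∑< N (λ k → ch b k * r k * (D i k * D i k))
    ≡⟨ ∑<-ext N (λ k → trans (*-assoc (ch b k) (r k) _) (trans (cong (ch b k *_) (r*D² i k))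
         (solve 4 (λ c a b d → c :* (a :* (b :* d :+ d :* d)) := a :* (c :* b :* d :+ c :* (d :* d))) refl
           (ch b k) (r i) (r k) (D i k)))) ⟩
  ∑< N (λ k → r i * (ch b k * r k * D i k + ch b k * (D i k * D i k)))
    ≡⟨ trans (∑<-*ˡ N (r i) _) (cong (r i *_) (trans (∑<-+ N _ _) (cong₂ _+_ (∑rD b i<N) (∑D²≡ b i<N)))) ⟩
  r i * QL b N i ∎

-- The squares (1/k + 1/(n-k))² and (1/k - 1/(n+k))², expanded and summed over k with signs. The
-- subtracted `ch b i * (r i * r i)` is the 1/k² at k = n, where the left side holds the junk value.
PL : Bool → ℕ → ℕ → ℚ
PL b N i = (A b 2 N + (r i * VD b N i + r i * VD b N i) + D²-sum b N i - ch b i * (r i * r i))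
         + (A b 2 N - (r i * VE b N i + r i * VE b N i) + E²-sum b N i)

∑rrD² : ∀ b {N i} → i ℕ.< N → ∑< N (λ k → ch b k * (r k * r k) * (D i k * D i k + E i k * E i k))
  ≡ r i * r i * PL b N i
∑rrD² b {N} {i} i<N = begin
  ∑< N (λ k → ch b k * (r k * r k) * (D i k * D i k + E i k * E i k))
    ≡⟨ ∑<-ext N pointwise ⟩
  ∑< N (λ k → x * ((c k * (r k * r k) + (f k + f k) + h k) + δ i k * - (c k * (r k * r k)))
            + x * (c k * (r k * r k) + - (f′ k + f′ k) + h′ k))
    ≡⟨ trans (∑<-+ N _ _) (cong₂ _+_
         (trans (∑<-*ˡ N x _) (cong (x *_) (trans (∑<-+ N _ _) (cong₂ _+_
           (trans (∑<-+ N _ _) (cong₂ _+_ (trans (∑<-+ N _ _) (cong₂ _+_ (pow2 b N)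
              (trans (∑<-+ N _ _) (cong₂ _+_ (∑rD b i<N) (∑rD b i<N))))) (∑D²≡ b i<N)))
           (∑<-δ N i (λ k → - (c k * (r k * r k))) i<N)))))
         (trans (∑<-*ˡ N x _) (cong (x *_)
           (trans (∑<-+ N _ _) (cong₂ _+_ (trans (∑<-+ N _ _) (cong₂ _+_ (pow2 b N)
              (trans (∑<-neg N _) (cong -_ (trans (∑<-+ N _ _) (cong₂ _+_ (∑rE b N i) (∑rE b N i)))))))
              (∑E²≡ b N i)))))) ⟩
  x * ((A b 2 N + (r i * VD b N i + r i * VD b N i) + D²-sum b N i) + - (ch b i * (r i * r i)))
    + x * (A b 2 N + - (r i * VE b N i + r i * VE b N i) + E²-sum b N i)
    ≡⟨ sym (*-distribˡ-+ x _ _) ⟩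
  x * PL b N i ∎
  where
  x = r i * r i
  c f f′ h h′ : ℕ → ℚ
  c = ch b
  f k = c k * r k * D i k
  f′ k = c k * r k * E i k
  h k = c k * (D i k * D i k)
  h′ k = c k * (E i k * E i k)
  squareD : ∀ k → r k * (r k * (D i k * D i k))
    ≡ r i * r i * (r k * r k + (r k * D i k + r k * D i k) + D i k * D i k) - δ i k * r k * (r i * r i * r i)
  squareD k = begin
    r k * (r k * (D i k * D i k))                          ≡⟨ cong (r k *_) (r*D² i k) ⟩
    r k * (r i * (r k * D i k + D i k * D i k))            ≡⟨ solve 3 (λ a b d → b :* (a :* (b :* d :+ d :* d))
                                                                := a :* (b :* (b :* d) :+ b :* (d :* d))) refl (r i) (r k) (D i k) ⟩
    r i * (r k * (r k * D i k) + r k * (D i k * D i k))    ≡⟨ cong₂ (λ u v → r i * (r k * u + v)) (r*D i k) (r*D² i k) ⟩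
    r i * (r k * (r i * (r k + D i k) - δ i k * (r i * r i)) + r i * (r k * D i k + D i k * D i k))
      ≡⟨ solve 4 (λ a b d e → a :* (b :* (a :* (b :+ d) :- e :* (a :* a)) :+ a :* (b :* d :+ d :* d))
           := a :* a :* (b :* b :+ (b :* d :+ b :* d) :+ d :* d) :- e :* b :* (a :* a :* a)) refl
           (r i) (r k) (D i k) (δ i k) ⟩
    r i * r i * (r k * r k + (r k * D i k + r k * D i k) + D i k * D i k) - δ i k * r k * (r i * r i * r i) ∎
  δ-r : ∀ k → δ i k * r k * (r i * r i * r i) ≡ r i * r i * (δ i k * (r k * r k))
  δ-r k = trans (solve 3 (λ a b e → e :* b :* (a :* a :* a) := a :* a :* ((e :* a) :* b)) refl (r i) (r k) (δ i k))
    (cong (λ z → r i * r i * z) (trans (cong (_* r k) (δ-subst r i k)) (*-assoc (δ i k) (r k) (r k))))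
  squareE : ∀ k → r k * (r k * (E i k * E i k))
    ≡ r i * r i * (r k * r k + - (r k * E i k + r k * E i k) + E i k * E i k)
  squareE k = trans (solve 2 (λ b d → b :* (b :* (d :* d)) := (b :* d) :* (b :* d)) refl (r k) (E i k))
    (trans (cong₂ _*_ (r*E i k) (r*E i k))
      (solve 3 (λ a b d → (a :* (b :- d)) :* (a :* (b :- d))
         := a :* a :* (b :* b :+ (:- (b :* d :+ b :* d)) :+ d :* d)) refl (r i) (r k) (E i k)))
  pointwise : ∀ k → c k * (r k * r k) * (D i k * D i k + E i k * E i k)
    ≡ x * ((c k * (r k * r k) + (f k + f k) + h k) + δ i k * - (c k * (r k * r k)))
      + x * (c k * (r k * r k) + - (f′ k + f′ k) + h′ k)
  pointwise k = trans
    (solve 4 (λ c b d e → c :* (b :* b) :* (d :* d :+ e :* e)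
       := c :* (b :* (b :* (d :* d)) :+ b :* (b :* (e :* e)))) refl (c k) (r k) (D i k) (E i k))
    (trans (cong₂ (λ u v → c k * (u + v))
        (trans (squareD k) (cong (λ z → r i * r i * (r k * r k + (r k * D i k + r k * D i k) + D i k * D i k) - z) (δ-r k)))
        (squareE k))
      (solve 6 (λ c x b d e p → c :* ((x :* (b :* b :+ (b :* d :+ b :* d) :+ d :* d) :- x :* (p :* (b :* b)))
            :+ x :* (b :* b :+ (:- (b :* e :+ b :* e)) :+ e :* e))
         := x :* ((c :* (b :* b) :+ (c :* b :* d :+ c :* b :* d) :+ c :* (d :* d)) :+ p :* (:- (c :* (b :* b))))
            :+ x :* (c :* (b :* b) :+ (:- (c :* b :* e :+ c :* b :* e)) :+ c :* (e :* e))) refl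
         (c k) x (r k) (D i k) (E i k) (δ i k)))

-- Unfolds two successors at a time, matching the reduction of the power of 1/n in steps of two.
double : ℕ → ℕ
double zero    = 0
double (suc m) = suc (suc (double m))

-- For n ≠ k, n⁻² · 2k/(n²-k²) = k⁻² · 2k/(n²-k²) - (2/k) n⁻², which gives the recursion; the last
-- summand is the correction 2/k³ at n = k. In the base case the partial sums at k coming from
-- 1/(n-k) and 1/(n+k) cancel. Only even powers reduce to this case; an odd one would end in 1/(n-k)
-- + 1/(n+k), where they add.
gsum : Bool → ℕ → ℕ → ℕ → ℚ
gsum c zero    N k = r k - ch c k * (eD c 1 N k + eE c 1 N k)
gsum c (suc m) N k = r k * (r k * gsum c m N k) + - (r k + r k) * A c (double (suc m)) N
  + (ch c k + ch c k) * (r k * (r k * (r k * r k ^^ double m)))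

∑G : ∀ c m {N k} → k ℕ.< N → ∑< N (λ n → ch c n * r n ^^ double m * G n k) ≡ gsum c m N k
∑G c zero {N} {k} k<N = begin
  ∑< N (λ n → ch c n * 1ℚ * G n k)
    ≡⟨ ∑<-ext N (λ n → trans (cong₂ (λ u v → ch c n * 1ℚ * (u - v)) (D-antisym n k) (E-sym n k))
         (solve 3 (λ c d e → c :* con 1ℚ :* ((:- d) :- e) := :- (c :* d :+ c :* e)) refl (ch c n) (D k n) (E k n))) ⟩
  ∑< N (λ n → - (ch c n * D k n + ch c n * E k n))
    ≡⟨ trans (∑<-neg N _) (cong -_ (trans (∑<-+ N _ _) (cong₂ _+_ (trans (∑D c k<N)
         (trans (*-distribˡ-+ (ch c k) (A c 1 k) (- A c 1 (N ∸ suc k))) (cong (_+ ch c k * - A c 1 (N ∸ suc k)) (ch-A-pred c 1 k)))) (∑E c N k)))) ⟩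
  - ((ch c k * A c 1 (suc k) - r k * 1ℚ + ch c k * - A c 1 (N ∸ suc k)) + ch c k * (A c 1 (suc k ℕ.+ N) - A c 1 (suc k)))
    ≡⟨ solve 6 (λ c a x m p n → :- ((c :* a :- x :* con 1ℚ :+ c :* (:- m)) :+ c :* (p :- a))
         := x :- c :* ((n :- m) :+ (p :- n))) refl
         (ch c k) (A c 1 (suc k)) (r k) (A c 1 (N ∸ suc k)) (A c 1 (suc k ℕ.+ N)) (A c 1 N) ⟩
  gsum c zero N k ∎
∑G c (suc m) {N} {k} k<N = begin
  ∑< N (λ n → ch c n * (r n * (r n * w n)) * G n k)
    ≡⟨ ∑<-ext N pointwise ⟩
  ∑< N (λ n → r k * r k * (ch c n * w n * G n k) + - (r k + r k) * (ch c n * (r n * (r n * w n)))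
            + δ k n * ((ch c n + ch c n) * (r k * (r k * (r k * w n)))))
    ≡⟨ trans (∑<-+ N _ _) (cong₂ _+_ (trans (∑<-+ N _ _) (cong₂ _+_
         (trans (∑<-*ˡ N (r k * r k) _) (trans (cong (λ z → r k * r k * z) (∑G c m k<N)) (*-assoc (r k) (r k) (gsum c m N k))))
         (∑<-*ˡ N (- (r k + r k)) _)))
         (∑<-δ N k (λ n → (ch c n + ch c n) * (r k * (r k * (r k * w n)))) k<N)) ⟩
  gsum c (suc m) N k ∎
  where
  w : ℕ → ℚ
  w n = r n ^^ double m
  -- One factor 1/n turns the difference `D` - `E` into a sum; the second factor, in `rrG`, turns it
  -- back.
  rG : ∀ n → r n * G n k ≡ r k * (D n k + E n k) - (r k + r k) * r n + δ n k * (r k * r k)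
  rG n = trans (solve 3 (λ a d e → a :* (d :- e) := a :* d :- a :* e) refl (r n) (D n k) (E n k))
    (trans (cong₂ _-_ (D-split n k) (E-split n k))
      (solve 5 (λ a b d e p → (b :* (d :- a) :+ p :* (b :* b)) :- b :* (a :- e)
         := b :* (d :+ e) :- (b :+ b) :* a :+ p :* (b :* b)) refl (r n) (r k) (D n k) (E n k) (δ n k)))
  rrG : ∀ n → r n * (r n * G n k)
    ≡ r k * r k * G n k - (r k + r k) * (r n * r n) + δ n k * (r k * r k * r k + r k * r k * r k)
  rrG n = begin
    r n * (r n * G n k)
      ≡⟨ cong (r n *_) (rG n) ⟩
    r n * (r k * (D n k + E n k) - (r k + r k) * r n + δ n k * (r k * r k))
      ≡⟨ solve 5 (λ a b d e p → a :* (b :* (d :+ e) :- (b :+ b) :* a :+ p :* (b :* b))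
           := b :* (a :* d :+ a :* e) :- (b :+ b) :* (a :* a) :+ (p :* a) :* (b :* b)) refl
           (r n) (r k) (D n k) (E n k) (δ n k) ⟩
    r k * (r n * D n k + r n * E n k) - (r k + r k) * (r n * r n) + δ n k * r n * (r k * r k)
      ≡⟨ cong₂ (λ u v → r k * u - (r k + r k) * (r n * r n) + v * (r k * r k))
           (cong₂ _+_ (D-split n k) (E-split n k)) (δ-subst r n k) ⟩
    r k * ((r k * (D n k - r n) + δ n k * (r k * r k)) + r k * (r n - E n k)) - (r k + r k) * (r n * r n) + δ n k * r k * (r k * r k)
      ≡⟨ solve 5 (λ a b d e p → b :* ((b :* (d :- a) :+ p :* (b :* b)) :+ b :* (a :- e)) :- (b :+ b) :* (a :* a) :+ p :* b :* (b :* b)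
           := b :* b :* (d :- e) :- (b :+ b) :* (a :* a) :+ p :* (b :* b :* b :+ b :* b :* b)) refl
           (r n) (r k) (D n k) (E n k) (δ n k) ⟩
    r k * r k * G n k - (r k + r k) * (r n * r n) + δ n k * (r k * r k * r k + r k * r k * r k) ∎
  pointwise : ∀ n → ch c n * (r n * (r n * w n)) * G n k
    ≡ r k * r k * (ch c n * w n * G n k) + - (r k + r k) * (ch c n * (r n * (r n * w n)))
      + δ k n * ((ch c n + ch c n) * (r k * (r k * (r k * w n))))
  pointwise n = trans
    (solve 4 (λ c a w g → c :* (a :* (a :* w)) :* g := c :* w :* (a :* (a :* g))) refl (ch c n) (r n) (w n) (G n k))
    (trans (cong (ch c n * w n *_) (trans (rrG n)
        (cong (λ z → r k * r k * G n k - (r k + r k) * (r n * r n) + z * (r k * r k * r k + r k * r k * r k)) (δ-sym n k))))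
      (solve 6 (λ c w a b g p → c :* w :* (b :* b :* g :- (b :+ b) :* (a :* a) :+ p :* (b :* b :* b :+ b :* b :* b))
         := b :* b :* (c :* w :* g) :+ (:- (b :+ b)) :* (c :* (a :* (a :* w)))
            :+ p :* ((c :+ c) :* (b :* (b :* (b :* w))))) refl
         (ch c n) (w n) (r n) (r k) (G n k) (δ k n)))

-- Null sequences and sequences with reducible limit

record Null (s : ℕ → ℚ) : Set where
  constructor null
  field eventually : ∀ ε → 0ℚ < ε → ∃[ N ] (∀ n → N ℕ.≤ n → ∣ s n ∣ < ε)

open Null

null-≤ : ∀ {s t} → (∀ n → ∣ s n ∣ ≤ ∣ t n ∣) → Null t → Null s
null-≤ h nt = null λ ε 0<ε → let (N , hN) = eventually nt ε 0<ε in
  N , λ n N≤n → ≤-<-trans (h n) (hN n N≤n)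

null-resp : ∀ {s t} → (∀ n → s n ≡ t n) → Null t → Null s
null-resp h = null-≤ λ n → ≤-reflexive (cong ∣_∣ (h n))

null-0 : Null (λ _ → 0ℚ)
null-0 = null λ ε 0<ε → 0 , λ _ _ → 0<ε

null-+ : ∀ {s t} → Null s → Null t → Null (λ n → s n + t n)
null-+ {s} {t} ns nt = null λ ε 0<ε →
  let (M , hM) = eventually ns (half ε) (half-pos 0<ε)
      (N , hN) = eventually nt (half ε) (half-pos 0<ε)
  in M ℕ.⊔ N , λ n n≥ → let (M≤n , N≤n) = ⊔-split M N n≥ in
  ≤-<-trans (∣p+q∣≤∣p∣+∣q∣ (s n) (t n))
    (subst (∣ s n ∣ + ∣ t n ∣ <_) (half+half ε) (+-mono-< (hM n M≤n) (hN n N≤n)))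

Bounded : (ℕ → ℚ) → Set
Bounded s = ∃[ B ] ∃[ N ] (0ℚ < B × (∀ n → N ℕ.≤ n → ∣ s n ∣ ≤ B))

null-* : ∀ {s t} → Bounded s → Null t → Null (λ n → s n * t n)
null-* {s} {t} (B , M , 0<B , hB) nt = null λ ε 0<ε →
  let (γ , 0<γ , Bγ) = shrink ε B 0<ε 0<B
      (N , hN) = eventually nt γ 0<γ
  in M ℕ.⊔ N , λ n n≥ → let (M≤n , N≤n) = ⊔-split M N n≥ in
  subst (∣ s n * t n ∣ <_) Bγ (∣*∣-bound (s n) (t n) 0<B (hB n M≤n) (hN n N≤n))

const-bounded : ∀ c → Bounded (λ _ → c)
const-bounded c = bound (λ _ → c) (const-cauchy c)

null-scale : ∀ c {s} → Null s → Null (λ n → c * s n)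
null-scale c = null-* (const-bounded c)

cauchy-∘ : ∀ {s} (f : ℕ → ℕ) → (∀ n → n ℕ.≤ f n) → Cauchy s → Null (λ n → s (f n) - s n)
cauchy-∘ f f≥ cs = null λ ε 0<ε → let (N , hN) = cs ε 0<ε in
  N , λ n N≤n → hN (f n) n (ℕ.≤-trans N≤n (f≥ n)) N≤n

cauchy-resp-null : ∀ {s t} → Null (λ n → s n - t n) → Cauchy t → Cauchy s
cauchy-resp-null {s} {t} nd ct ε 0<ε =
  let (M , hM) = eventually nd (half (half ε)) (half-pos (half-pos 0<ε))
      (N , hN) = ct (half ε) (half-pos 0<ε)
  in M ℕ.⊔ N , λ m n m≥ n≥ →
  let (M≤m , N≤m) = ⊔-split M N m≥
      (M≤n , N≤n) = ⊔-split M N n≥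
  in ≤-<-trans
    (subst (λ z → ∣ z ∣ ≤ (∣ s m - t m ∣ + ∣ s n - t n ∣) + ∣ t m - t n ∣)
      (solve 4 (λ a b c d → ((a :- b) :+ (:- (c :- d))) :+ (b :- d) := a :- c) refl (s m) (t m) (s n) (t n))
      (≤-trans (∣p+q∣≤∣p∣+∣q∣ ((s m - t m) + - (s n - t n)) (t m - t n))
        (+-monoˡ-≤ ∣ t m - t n ∣ (≤-trans (∣p+q∣≤∣p∣+∣q∣ (s m - t m) (- (s n - t n)))
          (≤-reflexive (cong (λ z → ∣ s m - t m ∣ + z) (∣-p∣≡∣p∣ (s n - t n))))))))
    (subst ((∣ s m - t m ∣ + ∣ s n - t n ∣) + ∣ t m - t n ∣ <_)
      (trans (cong (_+ half ε) (half+half (half ε))) (half+half ε))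
      (+-mono-< (+-mono-< (hM m M≤m) (hM n M≤n)) (hN m n N≤m N≤n)))

-- Polynomials in the generators, evaluated along the approximating sequences

gen : Generator → ℕ → ℚ
gen g = ℝ.seq (value g)

evₘ : Monomial → ℕ → ℚ
evₘ []      n = 1ℚ
evₘ (g ∷ u) n = gen g n * evₘ u n

ev : Polynomial → ℕ → ℚ
ev []            n = 0ℚ
ev ((c , u) ∷ P) n = c * evₘ u n + ev P n

evₘ-seq : ∀ u n → ℝ.seq (evalMonomial u) n ≡ evₘ u n
evₘ-seq []      n = refl
evₘ-seq (g ∷ u) n = cong (gen g n *_) (evₘ-seq u n)

ev-seq : ∀ P n → ℝ.seq ⟦ P ⟧ n ≡ ev P n
ev-seq []            n = refl
ev-seq ((c , u) ∷ P) n = cong₂ (λ x y → c * x + y) (evₘ-seq u n) (ev-seq P n)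

ev-cauchy : ∀ P → Cauchy (ev P)
ev-cauchy P = cauchy-resp-null {ev P} {ℝ.seq ⟦ P ⟧}
  (null-resp (λ n → trans (cong (λ z → ev P n - z) (ev-seq P n)) (+-inverseʳ (ev P n))) null-0)
  (ℝ.cauchy ⟦ P ⟧)

evₘ-++ : ∀ u v n → evₘ (u ++ v) n ≡ evₘ u n * evₘ v n
evₘ-++ []      v n = sym (*-identityˡ (evₘ v n))
evₘ-++ (g ∷ u) v n = trans (cong (gen g n *_) (evₘ-++ u v n))
  (sym (*-assoc (gen g n) (evₘ u n) (evₘ v n)))

ev-++ : ∀ P Q n → ev (P ++ Q) n ≡ ev P n + ev Q n
ev-++ []            Q n = sym (+-identityˡ (ev Q n))
ev-++ ((c , u) ∷ P) Q n = trans (cong (λ z → c * evₘ u n + z) (ev-++ P Q n))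
  (sym (+-assoc (c * evₘ u n) (ev P n) (ev Q n)))

_·ₚ_ : ℚ × Monomial → Polynomial → Polynomial
(c , u) ·ₚ Q = map (λ (d , v) → c * d , u ++ v) Q

ev-· : ∀ c u Q n → ev ((c , u) ·ₚ Q) n ≡ c * evₘ u n * ev Q n
ev-· c u []            n = sym (*-zeroʳ (c * evₘ u n))
ev-· c u ((d , v) ∷ Q) n = trans
  (cong₂ (λ x y → c * d * x + y) (evₘ-++ u v n) (ev-· c u Q n))
  (solve 5 (λ c x d y q → c :* d :* (x :* y) :+ c :* x :* q := c :* x :* (d :* y :+ q)) refl
    c (evₘ u n) d (evₘ v n) (ev Q n))

_*ₚ_ : Polynomial → Polynomial → Polynomial
[]      *ₚ Q = []
(t ∷ P) *ₚ Q = (t ·ₚ Q) ++ (P *ₚ Q)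

ev-* : ∀ P Q n → ev (P *ₚ Q) n ≡ ev P n * ev Q n
ev-* []            Q n = sym (*-zeroˡ (ev Q n))
ev-* ((c , u) ∷ P) Q n = trans (ev-++ ((c , u) ·ₚ Q) (P *ₚ Q) n)
  (trans (cong₂ _+_ (ev-· c u Q n) (ev-* P Q n))
    (sym (*-distribʳ-+ (ev Q n) (c * evₘ u n) (ev P n))))

-- Sequences converging to the value of a polynomial in the generators.
record 𝓡 (s : ℕ → ℚ) : Set where
  constructor 𝓻
  field
    poly  : Polynomial
    close : Null (λ n → s n - ev poly n)

𝓡-resp : ∀ {s t} → (∀ n → s n ≡ t n) → 𝓡 t → 𝓡 s
𝓡-resp h (𝓻 P nP) = 𝓻 P (null-resp (λ n → cong (_- ev P n) (h n)) nP)

𝓡-null : ∀ {s} → Null s → 𝓡 s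
𝓡-null {s} ns = 𝓻 [] (null-resp (λ n → +-identityʳ (s n)) ns)

𝓡-+ : ∀ {s t} → 𝓡 s → 𝓡 t → 𝓡 (λ n → s n + t n)
𝓡-+ {s} {t} (𝓻 P nP) (𝓻 Q nQ) = 𝓻 (P ++ Q) (null-resp
  (λ n → trans (cong (λ z → (s n + t n) - z) (ev-++ P Q n))
    (solve 4 (λ a b c d → (a :+ b) :- (c :+ d) := (a :- c) :+ (b :- d)) refl (s n) (t n) (ev P n) (ev Q n)))
  (null-+ nP nQ))

-- Convergence is inherited from the real number that the polynomial denotes. It supplies the
-- boundedness needed for products and the summability demanded by `Reducible`.
𝓡-cauchy : ∀ {s} → 𝓡 s → Cauchy s
𝓡-cauchy {s} (𝓻 P nP) = cauchy-resp-null {s} nP (ev-cauchy P)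

𝓡-* : ∀ {s t} → 𝓡 s → 𝓡 t → 𝓡 (λ n → s n * t n)
𝓡-* {s} {t} 𝓡s@(𝓻 P nP) (𝓻 Q nQ) = 𝓻 (P *ₚ Q) (null-resp
  (λ n → trans (cong (λ z → s n * t n - z) (ev-* P Q n))
    (solve 4 (λ a b c d → a :* b :- c :* d := a :* (b :- d) :+ d :* (a :- c)) refl (s n) (t n) (ev P n) (ev Q n)))
  (null-+ (null-* (bound s (𝓡-cauchy 𝓡s)) nQ) (null-* (bound (ev Q) (ev-cauchy Q)) nP)))

𝓡-const : ∀ c → 𝓡 (λ _ → c)
𝓡-const c = 𝓻 ((c , []) ∷ []) (null-resp
  (λ n → solve 1 (λ c → c :- (c :* con 1ℚ :+ con 0ℚ) := con 0ℚ) refl c) null-0)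

𝓡-scale : ∀ c {s} → 𝓡 s → 𝓡 (λ n → c * s n)
𝓡-scale c = 𝓡-* (𝓡-const c)

𝓡-neg : ∀ {s} → 𝓡 s → 𝓡 (λ n → - s n)
𝓡-neg {s} 𝓡s = 𝓡-resp (λ n → solve 1 (λ x → :- x := con (- 1ℚ) :* x) refl (s n)) (𝓡-scale (- 1ℚ) 𝓡s)

𝓡-value : ∀ g → 𝓡 (gen g)
𝓡-value g = 𝓻 ((1ℚ , g ∷ []) ∷ []) (null-resp
  (λ n → solve 1 (λ x → x :- (con 1ℚ :* (x :* con 1ℚ) :+ con 0ℚ) := con 0ℚ) refl (gen g n)) null-0)

𝓡-close : ∀ {s t} → Null (λ n → s n - t n) → 𝓡 t → 𝓡 s
𝓡-close {s} {t} nd 𝓡t = 𝓡-resp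
  (λ n → solve 2 (λ a b → a := (a :- b) :+ b) refl (s n) (t n)) (𝓡-+ (𝓡-null nd) 𝓡t)

𝓡-∘ : ∀ {s} (f : ℕ → ℕ) → (∀ n → n ℕ.≤ f n) → 𝓡 s → 𝓡 (λ n → s (f n))
𝓡-∘ {s} f f≥ 𝓡s = 𝓡-close (cauchy-∘ {s} f f≥ (𝓡-cauchy 𝓡s)) 𝓡s

𝓡⇒Reducible : (a : (n : ℕ) .{{_ : NonZero n}} → ℚ) → 𝓡 (λ N → ∑ N a) → Reducible a
𝓡⇒Reducible a 𝓡a@(𝓻 P nP) = 𝓡-cauchy 𝓡a , P , eventually
  (null-resp (λ N → cong (λ z → ∑ N a - z) (ev-seq P N)) nP)

-- Estimates

≤-*ʳ : ∀ {x y} z → 0ℚ ≤ z → x ≤ y → x * z ≤ y * z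
≤-*ʳ z h = *-monoʳ-≤-nonNeg z {{nonNegative h}}

≤-*ˡ : ∀ {x y} z → 0ℚ ≤ z → x ≤ y → z * x ≤ z * y
≤-*ˡ z h = *-monoˡ-≤-nonNeg z {{nonNegative h}}

^^-+ : ∀ x m n → x ^^ (m ℕ.+ n) ≡ x ^^ m * x ^^ n
^^-+ x zero    n = sym (*-identityˡ (x ^^ n))
^^-+ x (suc m) n = trans (cong (x *_) (^^-+ x m n)) (sym (*-assoc x (x ^^ m) (x ^^ n)))

^^-nonneg : ∀ {x} → 0ℚ ≤ x → ∀ p → 0ℚ ≤ x ^^ p
^^-nonneg h zero    = <⇒≤ (positive⁻¹ 1ℚ)
^^-nonneg h (suc p) = *-nonneg h (^^-nonneg h p)

^^-mono : ∀ {x y} → 0ℚ ≤ x → x ≤ y → ∀ p → x ^^ p ≤ y ^^ p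
^^-mono 0≤x x≤y zero    = ≤-refl
^^-mono 0≤x x≤y (suc p) = *-mono 0≤x (^^-nonneg (≤-trans 0≤x x≤y) p) x≤y (^^-mono 0≤x x≤y p)

1≤^^ : ∀ {x} → 1ℚ ≤ x → ∀ p → 1ℚ ≤ x ^^ p
1≤^^ h zero    = ≤-refl
1≤^^ h (suc p) = *-mono (<⇒≤ (positive⁻¹ 1ℚ)) (≤-trans (<⇒≤ (positive⁻¹ 1ℚ)) (1≤^^ h p)) h (1≤^^ h p)

^^-≤ˡ : ∀ {x} → 1ℚ ≤ x → ∀ p q → x ^^ p ≤ x ^^ (p ℕ.+ q)
^^-≤ˡ {x} h p q = subst₂ _≤_ (*-identityʳ (x ^^ p)) (sym (^^-+ x p q))
  (≤-*ˡ (x ^^ p) (^^-nonneg (≤-trans (<⇒≤ (positive⁻¹ 1ℚ)) h) p) (1≤^^ h q))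

-- A discrete mean value inequality; in the induction step the slack is (xᵖ⁺¹ - yᵖ⁺¹)(x - y), with p
-- the smaller exponent.
^^-diff : ∀ {x y} → 0ℚ ≤ y → y ≤ x → ∀ p → x ^^ suc p ≤ y ^^ suc p + ι (suc p) * x ^^ p * (x - y)
^^-diff {x} {y} 0≤y y≤x zero = ≤-reflexive
  (solve 2 (λ x y → x :* con 1ℚ := y :* con 1ℚ :+ con 1ℚ :* con 1ℚ :* (x :- y)) refl x y)
^^-diff {x} {y} 0≤y y≤x (suc p) = ≤-trans
  (≤-*ˡ x (≤-trans 0≤y y≤x) (^^-diff 0≤y y≤x p))
  (sub (subst (0ℚ ≤_)
    (trans (solve 5 (λ x y u v j → (u :- v) :* (x :- y)
              := (y :* v :+ (j :+ con 1ℚ) :* u :* (x :- y)) :- (x :* v :+ j :* u :* (x :- y))) refl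
              x y (x ^^ suc p) (y ^^ suc p) (ι (suc p)))
      (cong₂ _-_ (cong (λ j → y * y ^^ suc p + j * x ^^ suc p * (x - y)) (sym (ι-suc (suc p))))
        (solve 5 (λ x y w v j → x :* v :+ j :* (x :* w) :* (x :- y) := x :* (v :+ j :* w :* (x :- y))) refl
          x y (x ^^ p) (y ^^ suc p) (ι (suc p)))))
    (*-nonneg (sub⁻ (^^-mono 0≤y y≤x (suc p))) (sub⁻ y≤x))))

-- By the mean value inequality the increment of Hᵖ⁺² from n to n + 1 is at most (p + 2)
-- H(n+1)ᵖ⁺¹/(n+1), which the induction hypothesis bounds by the constant (p + 2)c; these increments
-- are then added up.
H^^≤ : ∀ p → ∃[ c ] (0ℚ ≤ c × (∀ n → H n ^^ suc p ≤ c * ι n))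
H^^≤ zero    = 1ℚ , <⇒≤ (positive⁻¹ 1ℚ) , λ n →
  subst₂ _≤_ (sym (*-identityʳ (H n))) (sym (*-identityˡ (ι n))) (H≤ι n)
H^^≤ (suc p) with H^^≤ p
... | c , 0≤c , hc = c′ , 0≤c′ , go
  where
  c′ = ι (suc (suc p)) * c
  0≤c′ = *-nonneg (0≤ι (suc (suc p))) 0≤c
  go : ∀ n → H n ^^ suc (suc p) ≤ c′ * ι n
  go zero    = ≤-reflexive (trans (*-zeroˡ (0ℚ ^^ suc p)) (sym (*-zeroʳ c′)))
  go (suc n) = ≤-trans (^^-diff (H-nonneg n) (≤+ˡ (0≤r n)) (suc p))
    (≤-trans
      (+-mono-≤ (go n) (≤-trans
        (≤-reflexive (solve 4 (λ j u h x → j :* u :* ((h :+ x) :- h) := (j :* x) :* u) refl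
          (ι (suc (suc p))) (H (suc n) ^^ suc p) (H n) (r n)))
        (≤-*ˡ (ι (suc (suc p)) * r n) (*-nonneg (0≤ι (suc (suc p))) (0≤r n)) (hc (suc n)))))
      (≤-reflexive (trans
        (solve 5 (λ j c i i′ x → j :* c :* i :+ j :* x :* (c :* i′) := j :* c :* (i :+ i′ :* x)) refl
          (ι (suc (suc p))) c (ι n) (ι (suc n)) (r n))
        (cong (λ z → c′ * z) (trans (cong (λ z → ι n + z) (ι*r n)) (sym (ι-suc n)))))))

-- The majorant `β` tends to 0 and dominates `r`, since 1 ≤ H. The predecessor makes the term 1/n
-- for n ≥ 1.
null-r : Null (λ n → r (ℕ.pred n))
null-r = null λ ε 0<ε → let (N , hN) = β-small ε 0<ε in
  suc N , λ { (suc n) (s≤s N≤n) → ≤-<-trans (r≤β n) (hN n N≤n) }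
  where
  r≤β : ∀ n → ∣ r n ∣ ≤ β n
  r≤β n = subst₂ _≤_ (trans (*-identityˡ (r n)) (sym (0≤p⇒∣p∣≡p (0≤r n)))) refl
    (≤-*ʳ (r n) (0≤r n)
      (≤-trans (1≤H n) (≤+ˡ (0≤ι 2))))

null-sqrt : ∀ {s} → Null (λ n → s n * s n) → Null s
null-sqrt {s} ns = null λ ε 0<ε → let (N , hN) = eventually ns (ε * ε) (*-pos 0<ε 0<ε) in
  N , λ n N≤n → ≰⇒> λ ε≤ → <-irrefl refl (≤-<-trans
    (subst (ε * ε ≤_) (sym (∣p*q∣≡∣p∣*∣q∣ (s n) (s n)))
      (*-mono (<⇒≤ 0<ε) (0≤∣p∣ (s n)) ε≤ ε≤)) (hN n N≤n))

-- (Hᵖ/N)² = H²ᵖ/N² = O(1/N), because H²ᵖ⁺¹ = O(N).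
null-H^^ : ∀ p → Null (λ n → H n ^^ p * r (ℕ.pred n))
null-H^^ p with H^^≤ (p ℕ.+ p)
... | c , 0≤c , hc = null-sqrt (null-cut (null-scale c null-r))
  where
  s : ℕ → ℚ
  s n = H n ^^ p * r (ℕ.pred n)
  bound′ : ∀ n → ∣ s (suc n) * s (suc n) ∣ ≤ ∣ c * r n ∣
  bound′ n = subst₂ _≤_ (sym (0≤p⇒∣p∣≡p (*-nonneg 0≤s 0≤s))) (sym (0≤p⇒∣p∣≡p (*-nonneg 0≤c (0≤r n))))
    (≤-trans
      (≤-reflexive (trans (solve 2 (λ h x → (h :* x) :* (h :* x) := (h :* h) :* (x :* x)) refl (H (suc n) ^^ p) (r n))
        (cong (_* (r n * r n)) (sym (^^-+ (H (suc n)) p p)))))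
      (≤-trans
        (≤-*ʳ (r n * r n) (*-nonneg (0≤r n) (0≤r n))
          (≤-trans (subst (_≤ H (suc n) * H (suc n) ^^ (p ℕ.+ p)) (*-identityˡ (H (suc n) ^^ (p ℕ.+ p)))
             (≤-*ʳ (H (suc n) ^^ (p ℕ.+ p)) (^^-nonneg (H-nonneg (suc n)) (p ℕ.+ p)) (1≤H n)))
            (hc (suc n))))
        (≤-reflexive (trans (solve 3 (λ c i x → c :* i :* (x :* x) := c :* (i :* x) :* x) refl c (ι (suc n)) (r n))
          (trans (cong (λ z → c * z * r n) (ι*r n)) (cong (_* r n) (*-identityʳ c)))))))
    where
    0≤s : 0ℚ ≤ s (suc n)
    0≤s = *-nonneg (^^-nonneg (H-nonneg (suc n)) p) (0≤r n)
  null-cut : Null (λ n → c * r (ℕ.pred n)) → Null (λ n → s n * s n)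
  null-cut nc = null λ ε 0<ε → let (N , hN) = eventually nc ε 0<ε in
    suc N , λ { (suc n) (s≤s N≤n) → ≤-<-trans (bound′ n) (hN (suc n) (ℕ.m≤n⇒m≤1+n N≤n)) }

∣ch∣ : ∀ b i → ∣ ch b i ∣ ≡ 1ℚ
∣ch∣ false i = refl
∣ch∣ true  i = go (suc i)
  where
  go : ∀ n → ∣ pw true n ∣ ≡ 1ℚ
  go zero    = refl
  go (suc n) = trans (∣-p∣≡∣p∣ (pw true n)) (go n)

∣ch*∣ : ∀ b i x → ∣ ch b i * x ∣ ≡ ∣ x ∣
∣ch*∣ b i x = trans (∣p*q∣≡∣p∣*∣q∣ (ch b i) x) (trans (cong (_* ∣ x ∣) (∣ch∣ b i)) (*-identityˡ ∣ x ∣))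

∣∑<∣≤ : ∀ n {f g : ℕ → ℚ} → (∀ i → i ℕ.< n → ∣ f i ∣ ≤ g i) → ∣ ∑< n f ∣ ≤ ∑< n g
∣∑<∣≤ zero        h = ≤-refl
∣∑<∣≤ (suc n) {f} h = ≤-trans (∣p+q∣≤∣p∣+∣q∣ (∑< n f) (f n))
  (+-mono-≤ (∣∑<∣≤ n λ i i<n → h i (ℕ.m≤n⇒m≤1+n i<n)) (h n ℕ.≤-refl))

H≡∑< : ∀ n → H n ≡ ∑< n r
H≡∑< = ∑≡∑< (λ j → + 1 / j)

r^^≤r : ∀ i p → r i ^^ suc p ≤ r i
r^^≤r i p = subst (r i ^^ suc p ≤_) (*-identityʳ (r i))
  (≤-*ˡ (r i) (0≤r i) (≤1 p))
  where
  ≤1 : ∀ p → r i ^^ p ≤ 1ℚ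
  ≤1 zero    = ≤-refl
  ≤1 (suc p) = ≤-trans (*-mono (0≤r i) (<⇒≤ (positive⁻¹ 1ℚ)) (r≤1 i) (≤1 p)) (≤-reflexive (*-identityʳ 1ℚ))

∣ch*r^^∣≤r : ∀ b i p → ∣ ch b i * r i ^^ suc p ∣ ≤ r i
∣ch*r^^∣≤r b i p = subst (_≤ r i)
  (sym (trans (∣ch*∣ b i (r i ^^ suc p)) (0≤p⇒∣p∣≡p (^^-nonneg (0≤r i) (suc p))))) (r^^≤r i p)

∣A∣≤H : ∀ b p n → ∣ A b (suc p) n ∣ ≤ H n
∣A∣≤H b p n = subst (∣ A b (suc p) n ∣ ≤_) (sym (H≡∑< n)) (∣∑<∣≤ n λ i _ → ∣ch*r^^∣≤r b i p)

∣A-A∣≤H-H : ∀ b p d n → ∣ A b (suc p) (d ℕ.+ n) - A b (suc p) n ∣ ≤ H (d ℕ.+ n) - H n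
∣A-A∣≤H-H b p zero    n = ≤-reflexive (trans (cong ∣_∣ (+-inverseʳ (A b (suc p) n))) (sym (+-inverseʳ (H n))))
∣A-A∣≤H-H b p (suc d) n = subst₂ _≤_
  (cong ∣_∣ (solve 3 (λ a x b → (a :- b) :+ x := (a :+ x) :- b) refl
    (A b (suc p) (d ℕ.+ n)) (ch b (d ℕ.+ n) * r (d ℕ.+ n) ^^ suc p) (A b (suc p) n)))
  (solve 3 (λ a x b → (a :- b) :+ x := (a :+ x) :- b) refl (H (d ℕ.+ n)) (r (d ℕ.+ n)) (H n))
  (≤-trans (∣p+q∣≤∣p∣+∣q∣ (A b (suc p) (d ℕ.+ n) - A b (suc p) n) _)
    (+-mono-≤ (∣A-A∣≤H-H b p d n) (∣ch*r^^∣≤r b (d ℕ.+ n) p)))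

H-mono : ∀ {m n} → m ℕ.≤ n → H m ≤ H n
H-mono {m} {n} m≤n = subst (λ k → H m ≤ H k) (ℕ.m∸n+n≡m m≤n) (go (n ∸ m))
  where
  go : ∀ d → H m ≤ H (d ℕ.+ m)
  go zero    = ≤-refl
  go (suc d) = ≤-trans (go d) (≤+ˡ (0≤r (d ℕ.+ m)))

-- Cross-multiplied monotonicity of (H(n) + 1)/n. Each step adds at most 1 on the left, and the
-- summand 1 on the right absorbs it even when H(m) = 0.
H+1-decreasing : ∀ d m → ι m * (H (d ℕ.+ m) + 1ℚ) ≤ ι (d ℕ.+ m) * (H m + 1ℚ)
H+1-decreasing zero    m = ≤-refl
H+1-decreasing (suc d) m = ≤-trans
  (≤-trans
    (≤-reflexive (solve 3 (λ i h x → i :* ((h :+ x) :+ con 1ℚ) := i :* (h :+ con 1ℚ) :+ i :* x) refl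
      (ι m) (H (d ℕ.+ m)) (r (d ℕ.+ m))))
    (+-mono-≤ (H+1-decreasing d m)
      (≤-trans
        (≤-trans (≤-*ʳ (r (d ℕ.+ m)) (0≤r (d ℕ.+ m)) (ι-mono (ℕ.m≤n⇒m≤1+n (ℕ.m≤n+m m d))))
          (≤-reflexive (ι*r (d ℕ.+ m))))
        (subst (_≤ H m + 1ℚ) (+-identityˡ 1ℚ) (+-monoˡ-≤ 1ℚ (H-nonneg m))))))
  (≤-reflexive (trans (solve 2 (λ i h → i :* h :+ h := (i :+ con 1ℚ) :* h) refl (ι (d ℕ.+ m)) (H m + 1ℚ))
    (cong (_* (H m + 1ℚ)) (sym (ι-suc (d ℕ.+ m))))))

-- n/N for n = i + 1; meaningful only for N ≥ 1.
fr : ℕ → ℕ → ℚ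
fr N i = ι (suc i) * r (ℕ.pred N)

0≤fr : ∀ N i → 0ℚ ≤ fr N i
0≤fr N i = *-nonneg (0≤ι (suc i)) (0≤r (ℕ.pred N))

fr≤1 : ∀ {N i} → i ℕ.< N → fr N i ≤ 1ℚ
fr≤1 {suc N} {i} i<N = ≤-trans
  (≤-*ʳ (r N) (0≤r N) (ι-mono i<N)) (≤-reflexive (ι*r N))

-- With m = N - n, monotonicity says m(H(N) + 1) ≤ N(H(m) + 1), which rearranges to this. The
-- reciprocals between m and N reach 1 when n = N, so a bound by n/N has to carry a factor such as 1
-- + H(N).
H-H≤ : ∀ {N i} → i ℕ.< N → H N - H (N ∸ suc i) ≤ (1ℚ + H N) * fr N i
H-H≤ {suc N} {i} i<N = subst₂ _≤_
  (trans (solve 4 (λ n h m x → (n :* (h :- m)) :* x := (n :* x) :* (h :- m)) refl (ι (suc N)) (H (suc N)) (H m) (r N))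
    (trans (cong (_* (H (suc N) - H m)) (ι*r N)) (*-identityˡ _)))
  (solve 3 (λ h i x → (i :* (h :+ con 1ℚ)) :* x := (con 1ℚ :+ h) :* (i :* x)) refl (H (suc N)) (ι (suc i)) (r N))
  (≤-*ʳ (r N) (0≤r N)
    (sub {ι (suc N) * (H (suc N) - H m)} {ι (suc i) * (H (suc N) + 1ℚ)} (subst (0ℚ ≤_)
      (trans (solve 4 (λ i j h g → (i :+ j) :* (g :+ con 1ℚ) :- j :* (h :+ con 1ℚ)
                := i :* (h :+ con 1ℚ) :- (i :+ j) :* (h :- g)) refl (ι (suc i)) (ι m) (H (suc N)) (H m))
        (cong (λ z → ι (suc i) * (H (suc N) + 1ℚ) - z * (H (suc N) - H m)) (trans (sym (ι-+ (suc i) m)) (cong ι eq))))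
      (sub⁻ (subst₂ _≤_ (cong (λ z → ι m * (H z + 1ℚ)) eq)
        (cong (_* (H m + 1ℚ)) (ι-+ (suc i) m)) (H+1-decreasing (suc i) m))))))
  where
  m = suc N ∸ suc i
  eq : suc i ℕ.+ m ≡ suc N
  eq = ℕ.m+[n∸m]≡n i<N

∣eD∣≤ : ∀ b p {N i} → i ℕ.< N → ∣ eD b (suc p) N i ∣ ≤ (1ℚ + H N) * fr N i
∣eD∣≤ b p {N} {i} i<N = ≤-trans
  (subst (λ k → ∣ A b (suc p) k - A b (suc p) m ∣ ≤ H k - H m) (ℕ.m+[n∸m]≡n i<N) (∣A-A∣≤H-H b p (suc i) m))
  (H-H≤ i<N)
  where m = N ∸ suc i

∣eE∣≤ : ∀ b p {N i} → i ℕ.< N → ∣ eE b (suc p) N i ∣ ≤ fr N i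
∣eE∣≤ b p {suc N} {i} _ = ≤-trans (∣A-A∣≤H-H b p (suc i) (suc N)) (go (suc i))
  where
  go : ∀ d → H (d ℕ.+ suc N) - H (suc N) ≤ ι d * r N
  go zero    = ≤-reflexive (trans (+-inverseʳ (H (suc N))) (sym (*-zeroˡ (r N))))
  go (suc d) = ≤-trans
    (≤-trans
      (≤-reflexive (solve 3 (λ a x b → (a :+ x) :- b := (a :- b) :+ x) refl (H (d ℕ.+ suc N)) (r (d ℕ.+ suc N)) (H (suc N))))
      (+-mono-≤ (go d) (r-mono (ℕ.≤-trans (ℕ.n≤1+n N) (ℕ.m≤n+m (suc N) d)))))
    (≤-reflexive (trans (solve 2 (λ i x → i :* x :+ x := (i :+ con 1ℚ) :* x) refl (ι d) (r N))
      (cong (_* r N) (sym (ι-suc d)))))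

-- Logarithmic growth and negligible truncation errors

record Tame (x : ℕ → ℕ → ℚ) : Set where
  field
    c   : ℚ
    p   : ℕ
    0≤c : 0ℚ ≤ c
    bd  : ∀ N i → i ℕ.< N → ∣ x N i ∣ ≤ c * H N ^^ p

-- The error is not small near n = N; it is only proportional to n/N. This suffices once it is
-- summed against n⁻² or a smaller weight, and it survives multiplication by anything tame.
record Negligible (x : ℕ → ℕ → ℚ) : Set where
  field
    c   : ℚ
    p   : ℕ
    0≤c : 0ℚ ≤ c
    bd  : ∀ N i → i ℕ.< N → ∣ x N i ∣ ≤ c * H N ^^ p * fr N i

private
  1≤H′ : ∀ {N i} → i ℕ.< N → 1ℚ ≤ H N
  1≤H′ {suc N} _ = 1≤H N

  0≤H^^ : ∀ N p → 0ℚ ≤ H N ^^ p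
  0≤H^^ N p = ^^-nonneg (H-nonneg N) p

tame-+ : ∀ {x y} → Tame x → Tame y → Tame (λ N i → x N i + y N i)
tame-+ {x} {y} tx ty = record
  { c = X.c + Y.c ; p = X.p ℕ.+ Y.p ; 0≤c = +-nonneg X.0≤c Y.0≤c
  ; bd = λ N i i<N → ≤-trans (∣p+q∣≤∣p∣+∣q∣ (x N i) (y N i)) (≤-trans
      (+-mono-≤
        (≤-trans (X.bd N i i<N) (≤-*ˡ X.c X.0≤c (^^-≤ˡ (1≤H′ i<N) X.p Y.p)))
        (≤-trans (Y.bd N i i<N) (≤-*ˡ Y.c Y.0≤c
          (subst (λ q → H N ^^ Y.p ≤ H N ^^ q) (ℕ.+-comm Y.p X.p) (^^-≤ˡ (1≤H′ i<N) Y.p X.p)))))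
      (≤-reflexive (sym (*-distribʳ-+ (H N ^^ (X.p ℕ.+ Y.p)) X.c Y.c)))) }
  where
  module X = Tame tx
  module Y = Tame ty

tame-* : ∀ {x y} → Tame x → Tame y → Tame (λ N i → x N i * y N i)
tame-* {x} {y} tx ty = record
  { c = X.c * Y.c ; p = X.p ℕ.+ Y.p ; 0≤c = *-nonneg X.0≤c Y.0≤c
  ; bd = λ N i i<N → subst₂ _≤_ (sym (∣p*q∣≡∣p∣*∣q∣ (x N i) (y N i)))
      (trans (solve 4 (λ c d g h → (c :* g) :* (d :* h) := (c :* d) :* (g :* h)) refl X.c Y.c (H N ^^ X.p) (H N ^^ Y.p))
        (cong (X.c * Y.c *_) (sym (^^-+ (H N) X.p Y.p))))
      (*-mono (0≤∣p∣ (x N i)) (*-nonneg Y.0≤c (0≤H^^ N Y.p)) (X.bd N i i<N) (Y.bd N i i<N)) }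
  where
  module X = Tame tx
  module Y = Tame ty

negligible⇒tame : ∀ {x} → Negligible x → Tame x
negligible⇒tame nx = record
  { c = X.c ; p = X.p ; 0≤c = X.0≤c
  ; bd = λ N i i<N → ≤-trans (X.bd N i i<N)
      (subst (X.c * H N ^^ X.p * fr N i ≤_) (*-identityʳ _)
        (≤-*ˡ (X.c * H N ^^ X.p) (*-nonneg X.0≤c (0≤H^^ N X.p)) (fr≤1 i<N))) }
  where module X = Negligible nx

negligible-* : ∀ {x y} → Negligible x → Tame y → Negligible (λ N i → x N i * y N i)
negligible-* {x} {y} nx ty = record
  { c = X.c * Y.c ; p = X.p ℕ.+ Y.p ; 0≤c = *-nonneg X.0≤c Y.0≤c
  ; bd = λ N i i<N → subst₂ _≤_ (sym (∣p*q∣≡∣p∣*∣q∣ (x N i) (y N i)))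
      (trans (solve 5 (λ c d g h f → (c :* g :* f) :* (d :* h) := (c :* d) :* (g :* h) :* f) refl
          X.c Y.c (H N ^^ X.p) (H N ^^ Y.p) (fr N i))
        (cong (λ z → X.c * Y.c * z * fr N i) (sym (^^-+ (H N) X.p Y.p))))
      (*-mono (0≤∣p∣ (x N i)) (*-nonneg Y.0≤c (0≤H^^ N Y.p)) (X.bd N i i<N) (Y.bd N i i<N)) }
  where
  module X = Negligible nx
  module Y = Tame ty

negligible-eD : ∀ b p → Negligible (eD b (suc p))
negligible-eD b p = record
  { c = ι 2 ; p = 1 ; 0≤c = 0≤ι 2
  ; bd = λ N i i<N → ≤-trans (∣eD∣≤ b p i<N)
      (≤-*ʳ (fr N i) (0≤fr N i)
        (≤-trans (+-monoˡ-≤ (H N) (1≤H′ i<N))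
          (≤-reflexive (solve 1 (λ h → h :+ h := con (ι 2) :* (h :* con 1ℚ)) refl (H N))))) }

negligible-eE : ∀ b p → Negligible (eE b (suc p))
negligible-eE b p = record
  { c = 1ℚ ; p = 0 ; 0≤c = <⇒≤ (positive⁻¹ 1ℚ)
  ; bd = λ N i i<N → subst (∣ eE b (suc p) N i ∣ ≤_) (sym (*-identityˡ (fr N i))) (∣eE∣≤ b p i<N) }

-- The weight n⁻² cancels the n of n/N and leaves c Hᵖ/(nN); summing 1/n costs one more factor H(N),
-- and Hᵖ⁺¹/N tends to 0.
negligible-sum : ∀ {x} → Negligible x → ∀ b q →
  Null (λ N → ∑< N (λ i → ch b i * r i ^^ suc (suc q) * x N i))
negligible-sum {x} nx b q = null-≤ (λ N → ≤-trans (sum-bound N) (≤-reflexive (sym (0≤p⇒∣p∣≡p (nonneg N)))))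
  (null-scale X.c (null-H^^ (suc X.p)))
  where
  module X = Negligible nx
  y : ℕ → ℚ
  y N = X.c * H N ^^ X.p * r (ℕ.pred N)
  nonneg : ∀ N → 0ℚ ≤ X.c * (H N ^^ suc X.p * r (ℕ.pred N))
  nonneg N = *-nonneg X.0≤c (*-nonneg (0≤H^^ N (suc X.p)) (0≤r (ℕ.pred N)))
  term : ∀ N i → i ℕ.< N → ∣ ch b i * r i ^^ suc (suc q) * x N i ∣ ≤ y N * r i
  term N i i<N = subst₂ _≤_
    (sym (trans (cong ∣_∣ (*-assoc (ch b i) (r i ^^ suc (suc q)) (x N i)))
      (trans (∣ch*∣ b i _) (trans (∣p*q∣≡∣p∣*∣q∣ (r i ^^ suc (suc q)) (x N i))
        (cong (_* ∣ x N i ∣) (0≤p⇒∣p∣≡p (^^-nonneg (0≤r i) (suc (suc q)))))))))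
    (trans (solve 4 (λ a c j f → (a :* a) :* (c :* (j :* f)) := (c :* f) :* (a :* (j :* a))) refl
        (r i) (X.c * H N ^^ X.p) (ι (suc i)) (r (ℕ.pred N)))
      (cong (λ z → y N * z) (trans (cong (r i *_) (ι*r i)) (*-identityʳ (r i)))))
    (*-mono (^^-nonneg (0≤r i) (suc (suc q)))
      (*-nonneg (*-nonneg X.0≤c (0≤H^^ N X.p)) (0≤fr N i))
      (≤-*ˡ (r i) (0≤r i) (r^^≤r i q)) (X.bd N i i<N))
  sum-bound : ∀ N → ∣ ∑< N (λ i → ch b i * r i ^^ suc (suc q) * x N i) ∣
    ≤ X.c * (H N ^^ suc X.p * r (ℕ.pred N))
  sum-bound N = ≤-trans (∣∑<∣≤ N (term N)) (≤-reflexive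
    (trans (∑<-*ˡ N (y N) r) (trans (cong (y N *_) (sym (H≡∑< N)))
      (solve 4 (λ c g f h → c :* g :* f :* h := c :* (h :* g :* f)) refl X.c (H N ^^ X.p) (r (ℕ.pred N)) (H N)))))

-- Linear sums

sgn≡ : ∀ i → sgn (suc i) ≡ - ch true i
sgn≡ i = trans (go i) (solve 1 (λ x → x := :- (:- x)) refl (pw true i))
  where
  go : ∀ i → sgn (suc i) ≡ pw true i
  go zero    = refl
  go (suc i) = cong -_ (go i)

ζₙ≡A : ∀ n p → ζₙ n p ≡ A false p n
ζₙ≡A n p = trans (∑≡∑< (λ j → 1/ j ^ p) n)
  (∑<-ext n λ i → trans (rpow i p) (sym (*-identityˡ (r i ^^ p))))

L≡-A : ∀ n p → L n p ≡ - A true p n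
L≡-A n p = trans (∑≡∑< (λ j → sgn j * 1/ j ^ p) n)
  (trans (∑<-ext n λ i → trans (cong₂ _*_ (sgn≡ i) (rpow i p)) (sym (neg-distribˡ-* (ch true i) (r i ^^ p))))
    (∑<-neg n (λ i → ch true i * r i ^^ p)))

H≡A : ∀ n → H n ≡ A false 1 n
H≡A n = trans (H≡∑< n) (∑<-ext n λ i → solve 1 (λ x → x := con 1ℚ :* (x :* con 1ℚ)) refl (r i))

𝓡-∑< : (a : (j : ℕ) .{{_ : NonZero j}} → ℚ) → ∀ c {f} → (∀ i → f i ≡ c * a (suc i)) →
  𝓡 (λ N → ∑ N a) → 𝓡 (λ N → ∑< N f)
𝓡-∑< a c h 𝓡a = 𝓡-resp
  (λ N → trans (∑<-ext N h) (trans (∑<-*ˡ N c (λ i → a (suc i))) (cong (c *_) (sym (∑≡∑< a N)))))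
  (𝓡-scale c 𝓡a)

private
  2≤ : ∀ {q} → 2 ℕ.≤ suc (suc q)
  2≤ = s≤s (s≤s z≤n)

  1≤ : ∀ {p} → 1 ℕ.≤ suc p
  1≤ = s≤s z≤n

-- The two signs select one of the four families of linear sums. The factors -1 arise because `L`
-- and `sgn` use (-1)ⁿ⁻¹ where `A` and `ch` use (-1)ⁿ.
𝓡-linear : ∀ b b′ p q →
  𝓡 (λ N → ∑< N (λ i → ch b i * r i ^^ suc (suc q) * A b′ (suc p) (suc i)))
𝓡-linear false false p q = 𝓡-∑< (λ n → ζₙ n (suc p) * 1/ n ^ suc (suc q)) 1ℚ
  (λ i → trans
    (solve 2 (λ x a → con 1ℚ :* x :* a := con 1ℚ :* (a :* x)) refl (r i ^^ suc (suc q)) (A false (suc p) (suc i)))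
    (cong (1ℚ *_) (sym (cong₂ _*_ (ζₙ≡A (suc i) (suc p)) (rpow i (suc (suc q)))))))
  (𝓡-value (Sζ (suc p) (suc (suc q)) 1≤ 2≤))
𝓡-linear false true p q = 𝓡-∑< (λ n → L n (suc p) * 1/ n ^ suc (suc q)) (- 1ℚ)
  (λ i → trans
    (solve 2 (λ x a → con 1ℚ :* x :* a := con (- 1ℚ) :* ((:- a) :* x)) refl (r i ^^ suc (suc q)) (A true (suc p) (suc i)))
    (cong (- 1ℚ *_) (sym (cong₂ _*_ (L≡-A (suc i) (suc p)) (rpow i (suc (suc q)))))))
  (𝓡-value (SL (suc p) (suc (suc q)) 1≤ 2≤))
𝓡-linear true false p q = 𝓡-∑< (λ n → ζₙ n (suc p) * 1/ n ^ suc (suc q) * sgn n) (- 1ℚ)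
  (λ i → trans
    (solve 3 (λ x a c → c :* x :* a := con (- 1ℚ) :* (a :* x :* (:- c))) refl
      (r i ^^ suc (suc q)) (A false (suc p) (suc i)) (ch true i))
    (cong (- 1ℚ *_) (sym (cong₂ _*_ (cong₂ _*_ (ζₙ≡A (suc i) (suc p)) (rpow i (suc (suc q)))) (sgn≡ i)))))
  (𝓡-value (Sζ± (suc p) (suc (suc q)) 1≤ 2≤))
𝓡-linear true true p q = 𝓡-∑< (λ n → L n (suc p) * 1/ n ^ suc (suc q) * sgn n) 1ℚ
  (λ i → trans
    (solve 3 (λ x a c → c :* x :* a := con 1ℚ :* ((:- a) :* x :* (:- c))) refl
      (r i ^^ suc (suc q)) (A true (suc p) (suc i)) (ch true i))
    (cong (1ℚ *_) (sym (cong₂ _*_ (cong₂ _*_ (L≡-A (suc i) (suc p)) (rpow i (suc (suc q)))) (sgn≡ i)))))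
  (𝓡-value (SL± (suc p) (suc (suc q)) 1≤ 2≤))

𝓡-ζ : ∀ q → 𝓡 (A false (suc (suc q)))
𝓡-ζ q = 𝓡-∑< (λ n → 1/ n ^ suc (suc q)) 1ℚ (λ i → cong (1ℚ *_) (sym (rpow i (suc (suc q)))))
  (𝓡-value (ζ (suc (suc q)) 2≤))

-- Alternating zeta values and ln 2

^^-* : ∀ x y p → (x * y) ^^ p ≡ x ^^ p * y ^^ p
^^-* x y zero    = refl
^^-* x y (suc p) = trans (cong (x * y *_) (^^-* x y p))
  (solve 4 (λ x y u v → x :* y :* (u :* v) := (x :* u) :* (y :* v)) refl x y (x ^^ p) (y ^^ p))

ch-even : ∀ N → ch true (N ℕ.+ N) ≡ - 1ℚ
ch-even N = cong -_ (trans (pw-+ true N N) (pw² true N))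

r-odd : ∀ N → r (suc (N ℕ.+ N)) ≡ r 1 * r N
r-odd N = trans (cong r (trans (sym (ℕ.+-suc N N)) (cong (λ k → N ℕ.+ suc k) (sym (ℕ.+-identityʳ N))))) (recip-* 1 N)

-- Terms with odd j cancel and those with even j double, each giving 2/(2j)ᵖ; the constant is 2 ·
-- 2⁻ᵖ.
A+A-even : ∀ p N → A false p (N ℕ.+ N) + A true p (N ℕ.+ N) ≡ (r 1 ^^ p + r 1 ^^ p) * A false p N
A+A-even p zero    = sym (*-zeroʳ (r 1 ^^ p + r 1 ^^ p))
A+A-even p (suc N) = begin
  A false p (suc N ℕ.+ suc N) + A true p (suc N ℕ.+ suc N)
    ≡⟨ cong (λ k → A false p (suc k) + A true p (suc k)) (ℕ.+-suc N N) ⟩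
  ((a + 1ℚ * x) + 1ℚ * y) + ((b + ch true M * x) + - ch true M * y)
    ≡⟨ cong (λ z → ((a + 1ℚ * x) + 1ℚ * y) + ((b + z * x) + - z * y)) (ch-even N) ⟩
  ((a + 1ℚ * x) + 1ℚ * y) + ((b + - 1ℚ * x) + - (- 1ℚ) * y)
    ≡⟨ solve 4 (λ a b x y → ((a :+ con 1ℚ :* x) :+ con 1ℚ :* y) :+ ((b :+ con (- 1ℚ) :* x) :+ con (- (- 1ℚ)) :* y)
         := (a :+ b) :+ (y :+ y)) refl a b x y ⟩
  (a + b) + (y + y)
    ≡⟨ cong₂ (λ u v → u + (v + v)) (A+A-even p N) (trans (cong (_^^ p) (r-odd N)) (^^-* (r 1) (r N) p)) ⟩
  c * A false p N + (r 1 ^^ p * r N ^^ p + r 1 ^^ p * r N ^^ p)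
    ≡⟨ solve 3 (λ h s z → (h :+ h) :* s :+ (h :* z :+ h :* z) := (h :+ h) :* (s :+ con 1ℚ :* z)) refl
         (r 1 ^^ p) (A false p N) (r N ^^ p) ⟩
  c * A false p (suc N) ∎
  where
  M = N ℕ.+ N
  a = A false p M
  b = A true p M
  x = r M ^^ p
  y = r (suc M) ^^ p
  c = r 1 ^^ p + r 1 ^^ p

-- Leibniz's argument: splitting off the first term gives a(0) - t, where t is the sum for the
-- shifted sequence and so lies between 0 and a(1).
alternating : ∀ M (a : ℕ → ℚ) → (∀ i → 0ℚ ≤ a i) → (∀ i → a (suc i) ≤ a i) →
  0ℚ ≤ ∑< M (λ i → pw true i * a i) × ∑< M (λ i → pw true i * a i) ≤ a 0
alternating zero    a pos dec = ≤-refl , pos 0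
alternating (suc M) a pos dec with alternating M (λ i → a (suc i)) (λ i → pos (suc i)) (λ i → dec (suc i))
... | lo , hi = subst (0ℚ ≤_) (sym eq) (sub⁻ (≤-trans hi (dec 0)))
              , subst (_≤ a 0) (sym eq) (sub (subst (0ℚ ≤_) (solve 2 (λ a t → t := a :- (a :- t)) refl (a 0) t) lo))
  where
  t = ∑< M (λ i → pw true i * a (suc i))
  eq : ∑< (suc M) (λ i → pw true i * a i) ≡ a 0 - t
  eq = trans (∑<-front M (λ i → pw true i * a i)) (cong₂ _+_ (*-identityˡ (a 0))
    (trans (∑<-ext M (λ i → sym (neg-distribˡ-* (pw true i) (a (suc i))))) (∑<-neg M (λ i → pw true i * a (suc i)))))

∣A-tail∣≤r : ∀ q N M → ∣ A true (suc q) N - A true (suc q) (N ℕ.+ M) ∣ ≤ r N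
∣A-tail∣≤r q N M = subst (_≤ r N)
  (sym (trans (cong (λ z → ∣ A true (suc q) N - z ∣) (∑<-append N M (λ i → ch true i * r i ^^ suc q)))
    (trans (cong ∣_∣ (solve 2 (λ s t → s :- (s :+ t) := :- t) refl (A true (suc q) N) _))
      (trans (∣-p∣≡∣p∣ _) (trans (cong ∣_∣ tail) (trans (∣ch*∣ true N t) (0≤p⇒∣p∣≡p (proj₁ alt))))))))
  (≤-trans (proj₂ alt) (subst (λ k → r k ^^ suc q ≤ r N) (sym (ℕ.+-identityʳ N)) (r^^≤r N q)))
  where
  a : ℕ → ℚ
  a i = r (N ℕ.+ i) ^^ suc q
  t = ∑< M (λ i → pw true i * a i)
  alt = alternating M a (λ i → ^^-nonneg (0≤r (N ℕ.+ i)) (suc q))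
    (λ i → ^^-mono (0≤r (N ℕ.+ suc i)) (r-mono (ℕ.+-monoʳ-≤ N (ℕ.n≤1+n i))) (suc q))
  tail : ∑< M (λ i → ch true (N ℕ.+ i) * r (N ℕ.+ i) ^^ suc q) ≡ ch true N * t
  tail = trans (∑<-ext M λ i → trans (cong (_* a i) (pw-+ true (suc N) i)) (*-assoc (ch true N) (pw true i) (a i)))
    (∑<-*ˡ M (ch true N) (λ i → pw true i * a i))

-- For exponent 1 the constant 2 · 2⁻¹ is 1, so the sum equals H(N) - H(2N), exactly the negated
-- Riemann sum that defines ln 2. For p ≥ 2 it is 2¹⁻ᵖ ζ_N(p) - ζ_{2N}(p).
𝓡-even : ∀ q → 𝓡 (λ N → A true (suc q) (N ℕ.+ N))
𝓡-even zero = 𝓡-resp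
  (λ N → trans (solve 2 (λ a b → b := (a :+ b) :- a) refl (A false 1 (N ℕ.+ N)) (A true 1 (N ℕ.+ N)))
    (trans (cong (_- A false 1 (N ℕ.+ N)) (A+A-even 1 N))
      (trans (cong (λ v → (r 1 ^^ 1 + r 1 ^^ 1) * A false 1 N - v) (split N))
        (solve 2 (λ a t → con (r 1 ^^ 1 + r 1 ^^ 1) :* a :- (a :+ t) := :- t) refl (A false 1 N) (ln2-approx N)))))
  (𝓡-neg (𝓡-value ln2))
  where
  split : ∀ N → A false 1 (N ℕ.+ N) ≡ A false 1 N + ln2-approx N
  split N = trans (∑<-append N N (λ i → 1ℚ * r i ^^ 1)) (cong (λ z → A false 1 N + z)
    (sym (trans (∑≡∑< (λ i → _/_ (+ 1) (N ℕ.+ i) {{n+i≢0 N i}}) N)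
      (∑<-ext N λ i → trans (/-cong {+ 1} {N ℕ.+ suc i} {+ 1} {suc (N ℕ.+ i)} {{n+i≢0 N (suc i)}} refl (ℕ.+-suc N i))
        (solve 1 (λ x → x := con 1ℚ :* (x :* con 1ℚ)) refl (r (N ℕ.+ i)))))))
𝓡-even (suc q) = 𝓡-resp
  (λ N → trans (solve 2 (λ a b → b := (a :+ b) :+ (:- a)) refl (A false (suc (suc q)) (N ℕ.+ N)) (A true (suc (suc q)) (N ℕ.+ N)))
    (cong (_+ - A false (suc (suc q)) (N ℕ.+ N)) (A+A-even (suc (suc q)) N)))
  (𝓡-+ (𝓡-scale (r 1 ^^ suc (suc q) + r 1 ^^ suc (suc q)) (𝓡-ζ q))
    (𝓡-neg (𝓡-∘ (λ N → N ℕ.+ N) (λ N → ℕ.m≤m+n N N) (𝓡-ζ q))))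

-- Passage from even truncations to all: the partial sums at N and 2N differ by at most the first
-- omitted term.
𝓡-alt : ∀ q → 𝓡 (A true (suc q))
𝓡-alt q = 𝓡-close
  (null-≤ (λ N → ≤-trans (∣A-tail∣≤r q N N)
      (≤-trans (r-mono (ℕ.pred[n]≤n {N})) (≤-reflexive (sym (0≤p⇒∣p∣≡p (0≤r (ℕ.pred N)))))))
    null-r)
  (𝓡-even q)

𝓡-A : ∀ b q → 𝓡 (A b (suc (suc q)))
𝓡-A false q = 𝓡-ζ q
𝓡-A true  q = 𝓡-alt (suc q)

-- Families whose weighted sums reduce, and their multipliers

wsum : Bool → ℕ → (ℕ → ℕ → ℚ) → ℕ → ℚ
wsum b q x N = ∑< N (λ i → ch b i * r i ^^ q * x N i)

-- x N i is a quantity attached to n = i + 1 in a sum truncated at N; Lin collects those whose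
-- weighted sums are all of the reducible kind, Mult the factors that preserve this.
record Lin (x : ℕ → ℕ → ℚ) : Set where
  field
    tame : Tame x
    sums : ∀ b q → 𝓡 (wsum b (suc (suc q)) x)

open Lin

record Mult (x : ℕ → ℕ → ℚ) : Set where
  constructor mult
  infixr 7 _⊙_
  field
    _⊙_ : ∀ {y} → Lin y → Lin (λ N i → x N i * y N i)

open Mult

lin-resp : ∀ {x y} → (∀ N i → i ℕ.< N → x N i ≡ y N i) → Lin y → Lin x
lin-resp h ly = record
  { tame = let open Tame (tame ly) in record
      { c = c ; p = p ; 0≤c = 0≤c
      ; bd = λ N i i<N → subst (λ z → ∣ z ∣ ≤ c * H N ^^ p) (sym (h N i i<N)) (bd N i i<N) }
  ; sums = λ b q → 𝓡-resp
      (λ N → ∑<-cong N λ i i<N → cong (ch b i * r i ^^ suc (suc q) *_) (h N i i<N)) (sums ly b q) }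

lin-+ : ∀ {x y} → Lin x → Lin y → Lin (λ N i → x N i + y N i)
lin-+ {x} {y} lx ly = record
  { tame = tame-+ (tame lx) (tame ly)
  ; sums = λ b q → 𝓡-resp
      (λ N → trans (∑<-ext N λ i → *-distribˡ-+ (ch b i * r i ^^ suc (suc q)) (x N i) (y N i)) (∑<-+ N _ _))
      (𝓡-+ (sums lx b q) (sums ly b q)) }

mult-resp : ∀ {x y} → (∀ N i → i ℕ.< N → x N i ≡ y N i) → Mult y → Mult x
mult-resp h m = mult λ {z} lz → lin-resp (λ N i i<N → cong (_* z N i) (h N i i<N)) (m ⊙ lz)

mult-+ : ∀ {x y} → Mult x → Mult y → Mult (λ N i → x N i + y N i)
mult-+ {x} {y} mx my = mult λ {z} lz →
  lin-resp (λ N i _ → *-distribʳ-+ (z N i) (x N i) (y N i)) (lin-+ (mx ⊙ lz) (my ⊙ lz))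

-- Multipliers compose, whereas a product of two members of `Lin` may already be a quadratic sum;
-- hence the two separate classes.
mult-* : ∀ {x y} → Mult x → Mult y → Mult (λ N i → x N i * y N i)
mult-* {x} {y} mx my = mult λ {z} lz →
  lin-resp (λ N i _ → *-assoc (x N i) (y N i) (z N i)) (mx ⊙ (my ⊙ lz))

mult-seq : ∀ {s} → 𝓡 s → Tame (λ N _ → s N) → Mult (λ N _ → s N)
mult-seq {s} 𝓡s ts = mult λ {y} ly → record
  { tame = tame-* ts (tame ly)
  ; sums = λ b q → 𝓡-resp
      (λ N → trans
        (∑<-ext N λ i → solve 3 (λ w c y → w :* (c :* y) := c :* (w :* y)) refl
          (ch b i * r i ^^ suc (suc q)) (s N) (y N i))
        (∑<-*ˡ N (s N) (λ i → ch b i * r i ^^ suc (suc q) * y N i)))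
      (𝓡-* 𝓡s (sums ly b q)) }

tame-const : ∀ k {x : ℕ → ℕ → ℚ} → (∀ N i → ∣ x N i ∣ ≤ ∣ k ∣) → Tame x
tame-const k h = record
  { c = ∣ k ∣ ; p = 0 ; 0≤c = 0≤∣p∣ k
  ; bd = λ N i _ → ≤-trans (h N i) (≤-reflexive (sym (*-identityʳ ∣ k ∣))) }

mult-const : ∀ k → Mult (λ _ _ → k)
mult-const k = mult-seq (𝓡-const k) (tame-const k λ _ _ → ≤-refl)

mult-neg : ∀ {x} → Mult x → Mult (λ N i → - x N i)
mult-neg {x} mx = mult-resp (λ N i _ → solve 1 (λ x → :- x := con (- 1ℚ) :* x) refl (x N i))
  (mult-* (mult-const (- 1ℚ)) mx)

lin-neg : ∀ {x} → Lin x → Lin (λ N i → - x N i)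
lin-neg {x} lx = lin-resp (λ N i _ → solve 1 (λ x → :- x := con (- 1ℚ) :* x) refl (x N i))
  (mult-const (- 1ℚ) ⊙ lx)

-- `Lin` asks for all signs and all exponents from 2 on, so a sign factor merely changes the sign of
-- the weight, just as a factor 1/n raises the exponent.
mult-ch : ∀ b → Mult (λ _ i → ch b i)
mult-ch b = mult λ {y} ly → record
  { tame = tame-* (tame-const 1ℚ λ _ i → ≤-reflexive (∣ch∣ b i)) (tame ly)
  ; sums = λ b′ q → 𝓡-resp
      (λ N → ∑<-ext N λ i → trans
        (solve 4 (λ c w d y → c :* w :* (d :* y) := (c :* d) :* w :* y) refl
          (ch b′ i) (r i ^^ suc (suc q)) (ch b i) (y N i))
        (cong (λ z → z * r i ^^ suc (suc q) * y N i) (pw-xor b′ b (suc i))))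
      (sums ly (b′ xor b) q) }

mult-r : Mult (λ _ i → r i)
mult-r = mult λ {y} ly → record
  { tame = tame-* (tame-const 1ℚ λ _ i → ≤-trans (≤-reflexive (0≤p⇒∣p∣≡p (0≤r i))) (r≤1 i)) (tame ly)
  ; sums = λ b q → 𝓡-resp
      (λ N → ∑<-ext N λ i → solve 4 (λ c x w y → c :* w :* (x :* y) := c :* (x :* w) :* y) refl
        (ch b i) (r i) (r i ^^ suc (suc q)) (y N i))
      (sums ly b (suc q)) }

mult-r^^ : ∀ q → Mult (λ _ i → r i ^^ q)
mult-r^^ zero    = mult-const 1ℚ
mult-r^^ (suc q) = mult-* mult-r (mult-r^^ q)

-- A tame cofactor leaves the product negligible, so its sums tend to 0. This is why `Lin` records
-- tameness.
mult-negligible : ∀ {x} → Negligible x → Mult x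
mult-negligible nx = mult λ ly → record
  { tame = tame-* (negligible⇒tame nx) (tame ly)
  ; sums = λ b q → 𝓡-null (negligible-sum (negligible-* nx (tame ly)) b q) }

lin-1 : Lin (λ _ _ → 1ℚ)
lin-1 = record
  { tame = tame-const 1ℚ λ _ _ → ≤-refl
  ; sums = λ b q → 𝓡-resp (λ N → ∑<-ext N λ i → *-identityʳ (ch b i * r i ^^ suc (suc q))) (𝓡-A b q) }

mult⇒lin : ∀ {x} → Mult x → Lin x
mult⇒lin {x} mx = lin-resp (λ N i _ → sym (*-identityʳ (x N i))) (mx ⊙ lin-1)

lin-A : ∀ b p → Lin (λ _ i → A b (suc p) (suc i))
lin-A b p = record
  { tame = record { c = 1ℚ ; p = 1 ; 0≤c = <⇒≤ (positive⁻¹ 1ℚ)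
      ; bd = λ N i i<N → ≤-trans (≤-trans (∣A∣≤H b p (suc i)) (H-mono i<N))
          (≤-reflexive (solve 1 (λ h → h := con 1ℚ :* (h :* con 1ℚ)) refl (H N))) }
  ; sums = λ b′ q → 𝓡-linear b′ b p q }

-- Convergence is a hypothesis because `A false 1` is the divergent harmonic sum.
mult-A∞ : ∀ b p → 𝓡 (A b (suc p)) → Mult (λ N _ → A b (suc p) N)
mult-A∞ b p 𝓡A = mult-seq 𝓡A record { c = 1ℚ ; p = 1 ; 0≤c = <⇒≤ (positive⁻¹ 1ℚ)
  ; bd = λ N i _ → ≤-trans (∣A∣≤H b p N)
      (≤-reflexive (solve 1 (λ h → h := con 1ℚ :* (h :* con 1ℚ)) refl (H N))) }

-- Quadratic sums

-- The divergent case meets the coefficient 0; in the other case the sum tends to -ln 2.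
mult-Ā : ∀ b → Mult (λ N i → (1ℚ - ch b i) * A b 1 N)
mult-Ā false = mult-resp (λ N _ _ → *-zeroˡ (A false 1 N)) (mult-const 0ℚ)
mult-Ā true  = mult-* (mult-+ (mult-const 1ℚ) (mult-neg (mult-ch true))) (mult-A∞ true 0 (𝓡-alt 0))

mult-λD : ∀ b → Mult (λD b)
mult-λD b = mult-+ (mult-+ (mult-Ā b) (mult-* (mult-ch b) (mult-negligible (negligible-eD b 0))))
  (mult-neg (mult-* (mult-+ (mult-const 1ℚ) (mult-ch b)) mult-r))

mult-λE : ∀ b → Mult (λE b)
mult-λE b = mult-+ (mult-Ā b) (mult-neg (mult-* (mult-ch b) (mult-negligible (negligible-eE b 0))))

lin-ch-A : ∀ b p → Lin (λ _ i → ch b i * A b (suc p) (suc i))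
lin-ch-A b p = mult-ch b ⊙ lin-A b p

lin-VD : ∀ b → Lin (VD b)
lin-VD b = lin-+ (lin-ch-A b 0) (mult⇒lin (mult-λD b))

lin-VE : ∀ b → Lin (VE b)
lin-VE b = lin-+ (lin-ch-A b 0) (mult⇒lin (mult-λE b))

mult-A₂ : ∀ b → Mult (λ N _ → A b 2 N)
mult-A₂ b = mult-A∞ b 1 (𝓡-A b 0)

lin-D² : ∀ b → Lin (D²-sum b)
lin-D² b = lin-+ (lin-+ (lin-ch-A b 1) (mult⇒lin (mult-neg (mult-r^^ 2))))
  (mult⇒lin (mult-+ (mult-* (mult-ch b) (mult-A₂ b))
    (mult-neg (mult-* (mult-ch b) (mult-negligible (negligible-eD b 1))))))

lin-E² : ∀ b → Lin (E²-sum b)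
lin-E² b = lin-+
  (mult⇒lin (mult-+ (mult-* (mult-ch b) (mult-A₂ b)) (mult-* (mult-ch b) (mult-negligible (negligible-eE b 1)))))
  (lin-neg (lin-ch-A b 1))

lin-QL : ∀ b → Lin (QL b)
lin-QL b = lin-+ (mult-r ⊙ lin-VD b) (lin-D² b)

lin-PL : ∀ b → Lin (PL b)
lin-PL b = lin-+
  (lin-+ (lin-+ (lin-+ (mult⇒lin (mult-A₂ b)) (lin-+ (mult-r ⊙ lin-VD b) (mult-r ⊙ lin-VD b))) (lin-D² b))
    (mult⇒lin (mult-neg (mult-* (mult-ch b) (mult-* mult-r mult-r)))))
  (lin-+ (lin-+ (mult⇒lin (mult-A₂ b)) (lin-neg (lin-+ (mult-r ⊙ lin-VE b) (mult-r ⊙ lin-VE b)))) (lin-E² b))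

mult-gsum : ∀ c m → Mult (gsum c m)
mult-gsum c zero = mult-+ mult-r (mult-neg (mult-* (mult-ch c)
  (mult-+ (mult-negligible (negligible-eD c 0)) (mult-negligible (negligible-eE c 0)))))
mult-gsum c (suc m) = mult-+
  (mult-+ (mult-* mult-r (mult-* mult-r (mult-gsum c m)))
    (mult-* (mult-neg (mult-+ mult-r mult-r)) (mult-A∞ c (suc (double m)) (𝓡-A c (double m)))))
  (mult-* (mult-+ (mult-ch c) (mult-ch c)) (mult-r^^ (suc (suc (suc (double m))))))

-- The triple sum T with q = `Q`: `w` is γⁿ n^{2-q}, and `u`, `v` are αᵏ/k, βˡ/l. `AA` is the wanted
-- quadratic term, still carrying the sign (αβ)ⁿ; `rest` collects the cross terms.
module Weights (γ α β : Bool) (m : ℕ) where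
  Q = suc (suc (double m))

  u v w : ℕ → ℚ
  u k = ch α k * r k
  v l = ch β l * r l
  w n = ch γ n * r n ^^ double m

  module _ (N : ℕ) where
    open TripleSum N w public

  AA rest : ℕ → ℕ → ℚ
  AA N i = (ch α i * ch β i) * (A α 1 (suc i) * A β 1 (suc i))
  rest N i = (λD β N i + λE β N i) * (ch α i * A α 1 (suc i))
    + ((λD α N i + λE α N i) * (ch β i * A β 1 (suc i))
    + (λD α N i * λD β N i + λE α N i * λE β N i))

  lin-rest : Lin rest
  lin-rest = lin-+ (mult-+ (mult-λD β) (mult-λE β) ⊙ lin-ch-A α 0)
    (lin-+ (mult-+ (mult-λD α) (mult-λE α) ⊙ lin-ch-A β 0)
      (mult⇒lin (mult-+ (mult-* (mult-λD α) (mult-λD β)) (mult-* (mult-λE α) (mult-λE β)))))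

  -- `VD` and `VE` share the leading part, so both halves of T yield the same `AA`. The two factors
  -- 1/n from the inner sums raise the exponent from q - 2 to q.
  left : ∀ N → ∑< N (λ n → w n * (Ds N u n * Ds N v n + Es N u n * Es N v n))
    ≡ (wsum γ Q AA N + wsum γ Q AA N) + wsum γ Q rest N
  left N = trans (∑<-cong N term) (trans (∑<-+ N _ _) (cong (_+ wsum γ Q rest N) (∑<-+ N _ _)))
    where
    term : ∀ n → n ℕ.< N → w n * (Ds N u n * Ds N v n + Es N u n * Es N v n)
      ≡ (ch γ n * r n ^^ Q * AA N n + ch γ n * r n ^^ Q * AA N n) + ch γ n * r n ^^ Q * rest N n
    term n n<N = trans
      (cong (λ z → w n * z) (cong₂ _+_ (cong₂ _*_ (∑rD α n<N) (∑rD β n<N)) (cong₂ _*_ (∑rE α N n) (∑rE β N n))))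
      (trans
        (solve 7 (λ c x p a b a′ b′ → c :* p :* ((x :* a) :* (x :* b) :+ (x :* a′) :* (x :* b′))
           := c :* (x :* (x :* p)) :* (a :* b :+ a′ :* b′)) refl
           (ch γ n) (r n) (r n ^^ double m) (VD α N n) (VD β N n) (VE α N n) (VE β N n))
        (solve 9 (λ y a b f g l μ l′ μ′ →
             y :* ((f :* a :+ l) :* (g :* b :+ μ) :+ (f :* a :+ l′) :* (g :* b :+ μ′))
           := (y :* ((f :* g) :* (a :* b)) :+ y :* ((f :* g) :* (a :* b)))
              :+ y :* ((μ :+ μ′) :* (f :* a) :+ ((l :+ l′) :* (g :* b) :+ (l :* μ :+ l′ :* μ′)))) refl
           (ch γ n * r n ^^ Q) (A α 1 (suc n)) (A β 1 (suc n)) (ch α n) (ch β n)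
           (λD α N n) (λD β N n) (λE α N n) (λE β N n)))

  -- `gsum` contains no partial sum at k, so it acts as a multiplier on the linear `VD`. The
  -- exponent 2 comes from the explicit 1/k and the one in `∑rD`.
  𝓡-g : ∀ a b → 𝓡 (λ N → ∑< N (λ k → ch a k * r k * (Ds N (λ l → ch b l * r l) k * g N k)))
  𝓡-g a b = 𝓡-resp
    (λ N → ∑<-cong N λ k k<N → trans
      (cong₂ (λ x y → ch a k * r k * (x * y)) (∑rD b k<N) (∑G γ m k<N))
      (solve 4 (λ c x p q → c :* x :* (x :* p :* q) := c :* (x :* (x :* con 1ℚ)) :* (q :* p)) refl
        (ch a k) (r k) (VD b N k) (gsum γ m N k)))
    (sums (mult-gsum γ m ⊙ lin-VD b) a 0)

  𝓡-D² : ∀ a b → 𝓡 (λ N → ∑< N (λ n → w n * (ch a n * r n) * D²s N (λ l → ch b l * r l) n))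
  𝓡-D² a b = 𝓡-resp
    (λ N → ∑<-cong N λ n n<N → trans
      (cong (λ z → w n * (ch a n * r n) * z) (∑rD² b n<N))
      (solve 5 (λ c d x p q → c :* p :* (d :* x) :* (x :* q) := c :* (x :* (x :* p)) :* (d :* q)) refl
        (ch γ n) (ch a n) (r n) (r n ^^ double m) (QL b N n)))
    (sums (mult-ch a ⊙ lin-QL b) γ (double m))

  𝓡-diagonal : 𝓡 (λ N → ∑< N (λ n → w n * ∑< N (λ k → u k * v k * (D n k * D n k + E n k * E n k))))
  𝓡-diagonal = 𝓡-resp
    (λ N → ∑<-cong N λ n n<N → trans
      (cong (λ z → w n * z) (trans (∑<-ext N (weight n)) (∑rrD² (α xor β) n<N)))
      (solve 4 (λ c x p q → c :* p :* (x :* x :* q) := c :* (x :* (x :* p)) :* q) refl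
        (ch γ n) (r n) (r n ^^ double m) (PL (α xor β) N n)))
    (sums (lin-PL (α xor β)) γ (double m))
    where
    weight : ∀ n k → u k * v k * (D n k * D n k + E n k * E n k)
      ≡ ch (α xor β) k * (r k * r k) * (D n k * D n k + E n k * E n k)
    weight n k = cong (_* (D n k * D n k + E n k * E n k)) (trans
      (solve 3 (λ a b x → (a :* x) :* (b :* x) := (a :* b) :* (x :* x)) refl (ch α k) (ch β k) (r k))
      (cong (_* (r k * r k)) (pw-xor α β (suc k))))

  𝓡-AA : 𝓡 (wsum γ Q AA)
  𝓡-AA = 𝓡-resp
    (λ N → trans
      (solve 2 (λ s t → s := con ½ :* (((s :+ s) :+ t) :+ (:- t))) refl (wsum γ Q AA N) (wsum γ Q rest N))
      (cong (λ z → ½ * (z + - wsum γ Q rest N)) (trans (sym (left N)) (triple-sum N u v))))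
    (𝓡-scale ½ (𝓡-+
      (𝓡-+ (𝓡-+ (𝓡-+ (𝓡-+ (𝓡-g α β) (𝓡-g β α)) (𝓡-D² α β)) (𝓡-D² β α)) 𝓡-diagonal)
      (𝓡-neg (sums lin-rest γ (double m)))))

xor-cancel : ∀ a b → (a xor b) xor b ≡ a
xor-cancel false false = refl
xor-cancel false true  = refl
xor-cancel true  false = refl
xor-cancel true  true  = refl

-- The sign of T is twisted by αβ beforehand, which undoes the (αβ)ⁿ inside `AA`.
𝓡-quadratic : ∀ γ α β m →
  𝓡 (wsum γ (suc (suc (double m))) (λ _ i → A α 1 (suc i) * A β 1 (suc i)))
𝓡-quadratic γ α β m = 𝓡-resp
  (λ N → ∑<-ext N λ i → trans
    (cong (λ z → z * r i ^^ Q * (A α 1 (suc i) * A β 1 (suc i))) (sign i))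
    (solve 4 (λ a b x y → a :* b :* x :* y := a :* x :* (b :* y)) refl
      (ch (γ xor (α xor β)) i) (ch α i * ch β i) (r i ^^ Q) (A α 1 (suc i) * A β 1 (suc i))))
  𝓡-AA
  where
  open Weights (γ xor (α xor β)) α β m
  sign : ∀ i → ch γ i ≡ ch (γ xor (α xor β)) i * (ch α i * ch β i)
  sign i = sym (trans (cong (ch (γ xor (α xor β)) i *_) (pw-xor α β (suc i)))
    (trans (pw-xor (γ xor (α xor β)) (α xor β) (suc i)) (cong (λ b → ch b i) (xor-cancel γ (α xor β)))))

-- Conversion to the stated series and odd denominators

double≡ : ∀ m → 2 ℕ.* m ≡ double m
double≡ zero    = refl
double≡ (suc m) = cong suc (trans (ℕ.+-suc m (m ℕ.+ 0)) (cong suc (double≡ m)))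

rpow-double : ∀ i m → 1/ suc i ^ (2 ℕ.* m) ≡ r i ^^ double m
rpow-double i m = trans (rpow i (2 ℕ.* m)) (cong (r i ^^_) (double≡ m))

reducible : (a : (j : ℕ) .{{_ : NonZero j}} → ℚ) → ∀ c {f} → (∀ i → a (suc i) ≡ c * f i) →
  𝓡 (λ N → ∑< N f) → Reducible a
reducible a c {f} h 𝓡f = 𝓡⇒Reducible a (𝓡-resp
  (λ N → trans (∑≡∑< a N) (trans (∑<-ext N h) (∑<-*ˡ N c f))) (𝓡-scale c 𝓡f))

module OddDenominators (m : ℕ) where
  Q = suc (suc (double m))

  -- The factor 1 - (-1)ⁿ selects odd n with weight 2, and there the partial sum `z` is a harmonic
  -- number. Squaring `z` gives three kinds of quadratic sums, each with and without an alternating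
  -- sign.
  z y : ℕ → ℚ
  z i = A false 1 (suc i) + A true 1 (suc i)
  y i = (1ℚ - ch true i) * (r i ^^ Q * (z i * z i))

  𝓡-y : 𝓡 (λ N → ∑< N y)
  𝓡-y = 𝓡-resp
    (λ N → trans (∑<-ext N λ i → solve 4 (λ c x a b →
          (con 1ℚ :- c) :* (x :* ((a :+ b) :* (a :+ b)))
          := (con 1ℚ :* x :* (a :* a) :+ (con (ι 2) :* (con 1ℚ :* x :* (a :* b)) :+ con 1ℚ :* x :* (b :* b)))
             :+ (:- (c :* x :* (a :* a) :+ (con (ι 2) :* (c :* x :* (a :* b)) :+ c :* x :* (b :* b))))) refl
          (ch true i) (r i ^^ Q) (A false 1 (suc i)) (A true 1 (suc i)))
      (trans (∑<-+ N _ _) (cong₂ _+_ (squares false N)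
        (trans (∑<-neg N _) (cong -_ (squares true N))))))
    (𝓡-+ (𝓡-squares false) (𝓡-neg (𝓡-squares true)))
    where
    s : Bool → Bool → Bool → ℕ → ℚ
    s γ α β = wsum γ Q (λ _ i → A α 1 (suc i) * A β 1 (suc i))
    squares : ∀ γ N → ∑< N (λ i → ch γ i * r i ^^ Q * (A false 1 (suc i) * A false 1 (suc i))
        + (ι 2 * (ch γ i * r i ^^ Q * (A false 1 (suc i) * A true 1 (suc i)))
           + ch γ i * r i ^^ Q * (A true 1 (suc i) * A true 1 (suc i))))
      ≡ s γ false false N + (ι 2 * s γ false true N + s γ true true N)
    squares γ N = trans (∑<-+ N _ _) (cong (λ t → s γ false false N + t)
      (trans (∑<-+ N _ _) (cong (_+ s γ true true N) (∑<-*ˡ N (ι 2) _))))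
    𝓡-squares : ∀ γ → 𝓡 (λ N → s γ false false N + (ι 2 * s γ false true N + s γ true true N))
    𝓡-squares γ = 𝓡-+ (𝓡-quadratic γ false false m)
      (𝓡-+ (𝓡-scale (ι 2) (𝓡-quadratic γ false true m)) (𝓡-quadratic γ true true m))

  h : ℕ → ℚ
  h j = H (suc j) * H (suc j) * r (suc (suc (j ℕ.+ j))) ^^ Q

  z-odd : ∀ j → z (j ℕ.+ j) ≡ H j
  z-odd j = begin
    (A false 1 J + 1ℚ * x) + (A true 1 J + ch true J * x)  ≡⟨ cong (λ c → (A false 1 J + 1ℚ * x) + (A true 1 J + c * x)) (ch-even j) ⟩
    (A false 1 J + 1ℚ * x) + (A true 1 J + - 1ℚ * x)       ≡⟨ solve 3 (λ a b x → (a :+ con 1ℚ :* x) :+ (b :+ con (- 1ℚ) :* x) := a :+ b) refl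
                                                               (A false 1 J) (A true 1 J) x ⟩
    A false 1 J + A true 1 J                               ≡⟨ A+A-even 1 j ⟩
    1ℚ * A false 1 j                                       ≡⟨ *-identityˡ (A false 1 j) ⟩
    A false 1 j                                            ≡⟨ sym (H≡A j) ⟩
    H j                                                    ∎
    where
    J = j ℕ.+ j
    x = r J ^^ 1

  y-even : ∀ j → y (suc (j ℕ.+ j)) ≡ 0ℚ
  y-even j = trans
    (cong (λ c → (1ℚ - - c) * (r J ^^ Q * (z J * z J))) (ch-even j))
    (*-zeroˡ (r J ^^ Q * (z J * z J)))
    where J = suc (j ℕ.+ j)

  y-odd : ∀ j → y (suc (suc (j ℕ.+ j))) ≡ ι 2 * h j
  y-odd j = trans
    (cong₂ (λ c t → (1ℚ - - (- c)) * (r J ^^ Q * (t * t))) (ch-even j)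
      (trans (cong z (sym (cong suc (ℕ.+-suc j j)))) (z-odd (suc j))))
    (solve 2 (λ x t → con (ι 2) :* (x :* (t :* t)) := con (ι 2) :* (t :* t :* x)) refl (r J ^^ Q) (H (suc j)))
    where J = suc (suc (j ℕ.+ j))

  ∑y-odd : ∀ N → ∑< (suc (N ℕ.+ N)) y ≡ ι 2 * ∑< N h
  -- The denominator 1 drops out because `z 0` = 1 - 1 = 0, so the odd denominators start at 3, as
  -- the series with 2n + 1 and n ≥ 1 requires.
  ∑y-odd zero = trans (+-identityˡ (y 0))
    (solve 1 (λ x → con (ι 2) :* (x :* (con 0ℚ :* con 0ℚ)) := con (ι 2) :* con 0ℚ) refl (r 0 ^^ Q))
  ∑y-odd (suc N) = begin
    ∑< (suc (suc N ℕ.+ suc N)) y                                                ≡⟨ cong (λ k → ∑< (suc (suc k)) y) (ℕ.+-suc N N) ⟩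
    ∑< (suc (N ℕ.+ N)) y + y (suc (N ℕ.+ N)) + y (suc (suc (N ℕ.+ N)))          ≡⟨ cong₂ _+_ (cong₂ _+_ (∑y-odd N) (y-even N)) (y-odd N) ⟩
    ι 2 * ∑< N h + 0ℚ + ι 2 * h N                                               ≡⟨ solve 2 (λ s t → con (ι 2) :* s :+ con 0ℚ :+ con (ι 2) :* t
                                                                                     := con (ι 2) :* (s :+ t)) refl (∑< N h) (h N) ⟩
    ι 2 * ∑< (suc N) h                                                          ∎

  𝓡-h : 𝓡 (λ N → ∑< N h)
  𝓡-h = 𝓡-resp
    (λ N → trans (solve 1 (λ s → s := con ½ :* (con (ι 2) :* s)) refl (∑< N h)) (cong (½ *_) (sym (∑y-odd N))))
    (𝓡-scale ½ (𝓡-∘ (λ N → suc (N ℕ.+ N)) (λ N → ℕ.m≤n⇒m≤1+n (ℕ.m≤m+n N N)) 𝓡-y))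

  h≡ : ∀ j → 1/ suc (2 ℕ.* suc j) ^ (2 ℕ.* suc m) ≡ r (suc (suc (j ℕ.+ j))) ^^ Q
  h≡ j = trans (rpow-double (2 ℕ.* suc j) (suc m))
    (cong (λ k → r k ^^ Q) (cong suc (trans (ℕ.+-suc j (j ℕ.+ 0)) (cong (λ k → suc (j ℕ.+ k)) (ℕ.+-identityʳ j)))))

theorem3p5 : (m : ℕ) .{{_ : NonZero m}} →
    Reducible (λ n → L n 1 * L n 1 * 1/ n ^ (2 *ℕ m) * sgn n)
    × Reducible (λ n → H n * L n 1 * 1/ n ^ (2 *ℕ m))
    × Reducible (λ n → H n * L n 1 * 1/ n ^ (2 *ℕ m) * sgn n)
    × Reducible (λ n → H n * H n * 1/ n ^ (2 *ℕ m))
    × Reducible (λ n → H n * H n * 1/ n ^ (2 *ℕ m) * sgn n)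
    × Reducible (λ n → L n 1 * L n 1 * 1/ n ^ (2 *ℕ m))
    × Reducible (λ n → H n * H n * 1/ suc (2 *ℕ n) ^ (2 *ℕ m))
theorem3p5 (suc m) =
    -- The constants 1 and -1 collect one factor -1 for each `L` and one for `sgn`, relative to
    -- `A true` and `ch true`.
    reducible (λ n → L n 1 * L n 1 * 1/ n ^ (2 *ℕ suc m) * sgn n) (- 1ℚ)
      (λ i → trans (cong₂ _*_ (cong₂ _*_ (cong₂ _*_ (lₙ i) (lₙ i)) (p i)) (sgn≡ i))
        (solve 3 (λ b x c → (:- b) :* (:- b) :* x :* (:- c) := con (- 1ℚ) :* (c :* x :* (b :* b))) refl (b i) (x i) (ch true i)))
      (𝓡-quadratic true true true m)
  , reducible (λ n → H n * L n 1 * 1/ n ^ (2 *ℕ suc m)) (- 1ℚ)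
      (λ i → trans (cong₂ _*_ (cong₂ _*_ (hₙ i) (lₙ i)) (p i))
        (solve 3 (λ a b x → a :* (:- b) :* x := con (- 1ℚ) :* (con 1ℚ :* x :* (a :* b))) refl (a i) (b i) (x i)))
      (𝓡-quadratic false false true m)
  , reducible (λ n → H n * L n 1 * 1/ n ^ (2 *ℕ suc m) * sgn n) 1ℚ
      (λ i → trans (cong₂ _*_ (cong₂ _*_ (cong₂ _*_ (hₙ i) (lₙ i)) (p i)) (sgn≡ i))
        (solve 4 (λ a b x c → a :* (:- b) :* x :* (:- c) := con 1ℚ :* (c :* x :* (a :* b))) refl (a i) (b i) (x i) (ch true i)))
      (𝓡-quadratic true false true m)
  , reducible (λ n → H n * H n * 1/ n ^ (2 *ℕ suc m)) 1ℚ
      (λ i → trans (cong₂ _*_ (cong₂ _*_ (hₙ i) (hₙ i)) (p i))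
        (solve 2 (λ a x → a :* a :* x := con 1ℚ :* (con 1ℚ :* x :* (a :* a))) refl (a i) (x i)))
      (𝓡-quadratic false false false m)
  , reducible (λ n → H n * H n * 1/ n ^ (2 *ℕ suc m) * sgn n) (- 1ℚ)
      (λ i → trans (cong₂ _*_ (cong₂ _*_ (cong₂ _*_ (hₙ i) (hₙ i)) (p i)) (sgn≡ i))
        (solve 3 (λ a x c → a :* a :* x :* (:- c) := con (- 1ℚ) :* (c :* x :* (a :* a))) refl (a i) (x i) (ch true i)))
      (𝓡-quadratic true false false m)
  , reducible (λ n → L n 1 * L n 1 * 1/ n ^ (2 *ℕ suc m)) 1ℚ
      (λ i → trans (cong₂ _*_ (cong₂ _*_ (lₙ i) (lₙ i)) (p i))
        (solve 2 (λ b x → (:- b) :* (:- b) :* x := con 1ℚ :* (con 1ℚ :* x :* (b :* b))) refl (b i) (x i)))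
      (𝓡-quadratic false true true m)
  , reducible (λ n → H n * H n * 1/ suc (2 *ℕ n) ^ (2 *ℕ suc m)) 1ℚ
      (λ j → trans (cong (H (suc j) * H (suc j) *_) (h≡ j)) (sym (*-identityˡ (h j))))
      𝓡-h
  where
  open OddDenominators m using (h; h≡; 𝓡-h)
  a b x : ℕ → ℚ
  a i = A false 1 (suc i)
  b i = A true 1 (suc i)
  x i = r i ^^ suc (suc (double m))
  hₙ : ∀ i → H (suc i) ≡ a i
  hₙ i = H≡A (suc i)
  lₙ : ∀ i → L (suc i) 1 ≡ - b i
  lₙ i = L≡-A (suc i) 1
  p : ∀ i → 1/ suc i ^ (2 *ℕ suc m) ≡ x i
  p i = rpow-double i (suc m)
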